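{- There are infinitely many planar $4$-connected essentially $6$-edge-connected $4$-regular simple graphs $G$ with $|E(G)|$ divisible by $3$ which admit no claw-decomposition.
   Context: A simple graph has no loops and no multiple edges. A graph is essentially $\lambda$-edge-connected if, for every edge cut of size strictly less than $\lambda$, all edges of the cut are incident with a common vertex. A claw is the star $K_{1,3}$; a claw-decomposition of $G$ is a partition of $E(G)$ into edge sets each of which induces a copy of $K_{1,3}$. -}

module Defs where

open import Data.Nat using (ℕ; zero; suc; _+_; _<_)
open import Data.Bool using (Bool; true; false; if_then_else_; _∧_; _∨_; _xor_)
open import Data.Fin using (Fin; _<?_)
import Data.Fin as F
open import Data.Integer as ℤ using (ℤ)
open import Data.List using (List; []; _∷_)
open import Data.Product using (Σ; _×_; _,_; ∃; ∃-syntax; proj₁; proj₂)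
open import Data.Sum using (_⊎_)
open import Relation.Nullary using (¬_)
open import Relation.Nullary.Decidable using (⌊_⌋)
open import Relation.Binary.PropositionalEquality using (_≡_; _≢_)

record Graph : Set where
  field
    n      : ℕ
    adj    : Fin n → Fin n → Bool
    sym    : ∀ i j → adj i j ≡ adj j i
    irrefl : ∀ i → adj i i ≡ false
open Graph public

count : ∀ {k} → (Fin k → Bool) → ℕ
count {zero}  f = 0
count {suc k} f = (if f F.zero then 1 else 0) + count (λ i → f (F.suc i))

_==_ : ∀ {k} → Fin k → Fin k → Bool
i == j = ⌊ i F.≟ j ⌋

sumF : ∀ {k} → (Fin k → ℕ) → ℕ
sumF {zero}  f = 0
sumF {suc k} f = f F.zero + sumF (λ i → f (F.suc i))

degree : (G : Graph) → Fin (n G) → ℕ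
degree G v = count (adj G v)

Regular : ℕ → Graph → Set
Regular k G = ∀ v → degree G v ≡ k

edgeCount : Graph → ℕ
edgeCount G = sumF (λ i → count (λ j → adj G i j ∧ ⌊ i <? j ⌋))

data Walk (G : Graph) (ok : Fin (n G) → Bool) : Fin (n G) → Fin (n G) → Set where
  here : ∀ {u} → Walk G ok u u
  step : ∀ {u v w} → adj G u v ≡ true → ok v ≡ true → Walk G ok v w → Walk G ok u w

ConnectedWithout : (G : Graph) → (Fin (n G) → Bool) → Set
ConnectedWithout G X =
  ∀ u v → X u ≡ false → X v ≡ false →
    Walk G (λ x → if X x then false else true) u v

KConnected : ℕ → Graph → Set
KConnected k G =
  k < n G × (∀ (X : Fin (n G) → Bool) → count X < k → ConnectedWithout G X)

cutSize : (G : Graph) → (Fin (n G) → Bool) → ℕ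
cutSize G S = sumF (λ i → count (λ j →
  adj G i j ∧ ⌊ i <? j ⌋ ∧ (S i xor S j)))

EssEdgeConnected : ℕ → Graph → Set
EssEdgeConnected λ' G =
  ∀ (S : Fin (n G) → Bool) →
    (∃[ a ] S a ≡ true) → (∃[ b ] S b ≡ false) →
    cutSize G S < λ' →
    ∃[ v ] (∀ i j → adj G i j ≡ true → (S i xor S j) ≡ true → (i ≡ v ⊎ j ≡ v))

record Claw (G : Graph) : Set where
  field
    c a b d : Fin (n G)
    ca : adj G c a ≡ true
    cb : adj G c b ≡ true
    cd : adj G c d ≡ true
    a≢b : a ≢ b
    a≢d : a ≢ d
    b≢d : b ≢ d

inClaw : ∀ {G} → Claw G → Fin (n G) → Fin (n G) → Bool
inClaw K i j =
  ((i == c) ∧ ((j == a) ∨ (j == b) ∨ (j == d))) ∨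
  ((j == c) ∧ ((i == a) ∨ (i == b) ∨ (i == d)))
  where open Claw K

countClaws : ∀ {G} → List (Claw G) → Fin (n G) → Fin (n G) → ℕ
countClaws []       i j = 0
countClaws (K ∷ Ks) i j = (if inClaw K i j then 1 else 0) + countClaws Ks i j

ClawDecomposition : Graph → Set
ClawDecomposition G =
  Σ (List (Claw G)) λ Ks → ∀ i j → adj G i j ≡ true → countClaws Ks i j ≡ 1

-- Planarity, via straight-line drawings with integer coordinates
-- (equivalent to planarity by Fáry's theorem)

Point : Set
Point = ℤ × ℤ

-- cross product (q - p) × (r - p)
orient : Point → Point → Point → ℤ
orient (px , py) (qx , qy) (rx , ry) =
  ((qx ℤ.- px) ℤ.* (ry ℤ.- py)) ℤ.- ((qy ℤ.- py) ℤ.* (rx ℤ.- px))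

OnSeg : Point → Point → Point → Set
OnSeg p q r =
  orient p q r ≡ ℤ.0ℤ ×
  ((proj₁ p ℤ.⊓ proj₁ q) ℤ.≤ proj₁ r) × (proj₁ r ℤ.≤ (proj₁ p ℤ.⊔ proj₁ q)) ×
  ((proj₂ p ℤ.⊓ proj₂ q) ℤ.≤ proj₂ r) × (proj₂ r ℤ.≤ (proj₂ p ℤ.⊔ proj₂ q))

-- closed segments ab and cd share a point (standard orientation test)
SegIntersect : Point → Point → Point → Point → Set
SegIntersect a b c d =
  ((orient a b c ℤ.* orient a b d) ℤ.< ℤ.0ℤ × (orient c d a ℤ.* orient c d b) ℤ.< ℤ.0ℤ)
  ⊎ OnSeg a b c ⊎ OnSeg a b d ⊎ OnSeg c d a ⊎ OnSeg c d b

record PlaneDrawing (G : Graph) : Set where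
  field
    pos         : Fin (n G) → Point
    injective   : ∀ i j → pos i ≡ pos j → i ≡ j
    offEdges    : ∀ p q r → adj G p q ≡ true → r ≢ p → r ≢ q →
                  ¬ OnSeg (pos p) (pos q) (pos r)
    noCrossings : ∀ p q r s → adj G p q ≡ true → adj G r s ≡ true →
                  r ≢ p → r ≢ q → s ≢ p → s ≢ q →
                  ¬ SegIntersect (pos p) (pos q) (pos r) (pos s)

Planar : Graph → Set
Planar G = PlaneDrawing G

{-# OPTIONS --safe #-}
-- The centres of a claw decomposition of a 4-regular graph form a vertex cover, and the number of claws is two
-- thirds of the number of vertices; so there is no decomposition when every vertex cover is larger than that.
-- Let H be the square of the 16-cycle with the chords 0–2, 6–8 and 12–14 removed. It has no independent set of
-- six vertices, since around the cycle consecutive members would be at least three steps apart except across a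
-- removed chord, and the removed chords are placed so that no combination of short steps closes up. Hence any
-- cover of H has at least 11 > 2/3 · 16 vertices. The six vertices of degree three in H lie on one face, three are
-- used as left and three as right attachments, and a ring of k copies of H, each joined to the next by three links,
-- is 4-regular and planar with 16 k vertices.
--
-- Both connectivity properties reduce to finitely many facts about one block. A cut of the ring with fewer than
-- six edges cannot cross two blocks (each costs three), nor one block and a link elsewhere, nor two places between
-- blocks, so it lives in one block with the rest contracted to a vertex. Three deleted vertices cannot interrupt
-- the ring of the blocks that lose at most one vertex, and every remaining vertex of a block can leave its block.
module Submission where

-- The square of an even cycle is the graph of an antiprism, whose even vertices bound a face. The
-- removed chords join even vertices, so deleting them only enlarges that face, and all six
-- attachments stay on it. Six independent vertices would leave six gaps of total 16, so at least
-- two of them have length two and sit at removed chords. With exactly two short gaps all others are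
-- three, but no arc left between two removed chords has length divisible by three. With three short
-- gaps both 14 and 0 would belong to the set, and these are adjacent. A ring has 32 k edges, hence
-- k is a multiple of three. Two obstacles shape the rest. A block has 2^16 vertex subsets, or 2^22
-- together with its six neighbours; they are decided by a search that drops a branch as soon as a
-- monotone bound is reached. A drawing is needed for every k, while the closing links grow with k;
-- disjointness is therefore certified by separating lines, which survive translation and, with the
-- right slope, the prolongation of a horizontal segment.

module Sums where

  -- Finite sums, double counting, and counting along lists of arcs.

  open import Defs hiding (sym)
  open import Data.Bool using (Bool; true; false; if_then_else_; _∧_; _∨_)
  open import Data.Fin using (Fin; zero; suc; _↑ˡ_; _↑ʳ_; combine; _<?_)
  import Data.Fin as F
  import Data.Fin.Properties as FP
  open import Data.List using (List; []; _∷_)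
  open import Data.List.Relation.Unary.All using (All; []; _∷_)
  open import Data.List.Relation.Unary.AllPairs using ([]; _∷_)
  open import Data.List.Relation.Unary.Unique.Propositional using (Unique)
  open import Data.Nat hiding (_<?_)
  open import Data.Nat.Properties hiding (_<?_)
  open import Data.Product using (_×_; _,_; proj₁; proj₂)
  open import Data.Sum using (_⊎_; inj₁; inj₂)
  open import Relation.Nullary using (yes; no; contradiction)
  open import Relation.Nullary.Decidable using (⌊_⌋)
  open import Relation.Binary.PropositionalEquality
  open import Relation.Binary.Definitions using (tri<; tri≈; tri>)
  open import Algebra.Properties.CommutativeSemigroup +-commutativeSemigroup using (interchange)

  ind : Bool → ℕ
  ind b = if b then 1 else 0

  ==-refl : ∀ {k} (i : Fin k) → (i == i) ≡ true
  ==-refl i with i F.≟ i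
  ... | yes _ = refl
  ... | no i≢i = contradiction refl i≢i

  ==-≢ : ∀ {k} {i j : Fin k} → i ≢ j → (i == j) ≡ false
  ==-≢ {i = i} {j} i≢j with i F.≟ j
  ... | yes i≡j = contradiction i≡j i≢j
  ... | no _ = refl

  ==⇒≡ : ∀ {k} {i j : Fin k} → (i == j) ≡ true → i ≡ j
  ==⇒≡ {i = i} {j} e with i F.≟ j
  ... | yes i≡j = i≡j

  ∧-true : ∀ {x y} → x ∧ y ≡ true → x ≡ true × y ≡ true
  ∧-true {true} {true} _ = refl , refl

  ∨-true : ∀ {x y} → x ∨ y ≡ true → x ≡ true ⊎ y ≡ true
  ∨-true {true} _ = inj₁ refl
  ∨-true {false} e = inj₂ e

  true-iff : ∀ {x y} → (x ≡ true → y ≡ true) → (y ≡ true → x ≡ true) → x ≡ y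
  true-iff {true} {y} f g = sym (f refl)
  true-iff {false} {true} f g = g refl
  true-iff {false} {false} f g = refl

  ind-mono : ∀ {x y} → (x ≡ true → y ≡ true) → ind x ≤ ind y
  ind-mono {false} _ = z≤n
  ind-mono {true} {true} _ = ≤-refl
  ind-mono {true} {false} x⇒y with () ← x⇒y refl

  count≡sum : ∀ {k} (f : Fin k → Bool) → count f ≡ sumF (λ i → ind (f i))
  count≡sum {zero} f = refl
  count≡sum {suc k} f = cong (ind (f zero) +_) (count≡sum (λ i → f (suc i)))

  sum-cong : ∀ {k} {f g : Fin k → ℕ} → (∀ i → f i ≡ g i) → sumF f ≡ sumF g
  sum-cong {zero} f≗g = refl
  sum-cong {suc k} f≗g = cong₂ _+_ (f≗g zero) (sum-cong (λ i → f≗g (suc i)))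

  sum-mono : ∀ {k} {f g : Fin k → ℕ} → (∀ i → f i ≤ g i) → sumF f ≤ sumF g
  sum-mono {zero} f≤g = z≤n
  sum-mono {suc k} f≤g = +-mono-≤ (f≤g zero) (sum-mono (λ i → f≤g (suc i)))

  sum-+ : ∀ {k} (f g : Fin k → ℕ) → sumF (λ i → f i + g i) ≡ sumF f + sumF g
  sum-+ {zero} f g = refl
  sum-+ {suc k} f g = trans
    (cong (f zero + g zero +_) (sum-+ (λ i → f (suc i)) (λ i → g (suc i))))
    (interchange (f zero) (g zero) _ _)

  sum-const : ∀ k c → sumF {k} (λ _ → c) ≡ k * c
  sum-const zero c = refl
  sum-const (suc k) c = cong (c +_) (sum-const k c)

  sum-*ʳ : ∀ {k} (f : Fin k → ℕ) c → sumF (λ i → f i * c) ≡ sumF f * c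
  sum-*ʳ {zero} f c = refl
  sum-*ʳ {suc k} f c = trans (cong (f zero * c +_) (sum-*ʳ (λ i → f (suc i)) c)) (sym (*-distribʳ-+ c (f zero) _))

  sum-zero : ∀ {k} {f : Fin k → ℕ} → (∀ i → f i ≡ 0) → sumF f ≡ 0
  sum-zero {k} f≗0 = trans (sum-cong f≗0) (trans (sum-const k 0) (*-zeroʳ k))

  sum-swap : ∀ {k l} (f : Fin k → Fin l → ℕ) →
             sumF (λ i → sumF (f i)) ≡ sumF (λ j → sumF (λ i → f i j))
  sum-swap {zero} {l} f = sym (sum-zero {l} λ _ → refl)
  sum-swap {suc k} f = trans
    (cong (sumF (f zero) +_) (sum-swap (λ i → f (suc i))))
    (sym (sum-+ (f zero) _))

  sum-if : ∀ {k} b (f : Fin k → ℕ) →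
           sumF (λ i → if b then f i else 0) ≡ (if b then sumF f else 0)
  sum-if true f = refl
  sum-if {k} false f = sum-zero {k} λ _ → refl

  sum-if₃ : ∀ {k} x y z (f g h : Fin k → ℕ) →
            sumF (λ i → (if x then f i else 0) + ((if y then g i else 0) + (if z then h i else 0))) ≡
            (if x then sumF f else 0) + ((if y then sumF g else 0) + (if z then sumF h else 0))
  sum-if₃ {k} x y z f g h = trans (sum-+ {k} _ _) (cong₂ _+_ (sum-if x f)
    (trans (sum-+ {k} _ _) (cong₂ _+_ (sum-if y g) (sum-if z h))))

  sum-δ : ∀ {k} (i : Fin k) (g : Fin k → ℕ) →
          sumF (λ j → if j == i then g j else 0) ≡ g i
  sum-δ {suc k} zero g = trans (cong (g zero +_) (sum-zero {k} λ _ → refl)) (+-identityʳ _)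
  sum-δ (suc i) g = trans (sum-cong λ j → cong (if_then g (suc j) else 0) (suc-== j i)) (sum-δ i (λ j → g (suc j)))
    where
    suc-== : ∀ {k} (j i : Fin k) → (F.suc j == F.suc i) ≡ (j == i)
    suc-== j i with j F.≟ i
    ... | yes _ = refl
    ... | no _ = refl

  sum-≥₁ : ∀ {k} (f : Fin k → ℕ) i → f i ≤ sumF f
  sum-≥₁ f zero = m≤m+n _ _
  sum-≥₁ f (suc i) = ≤-trans (sum-≥₁ (λ j → f (suc j)) i) (m≤n+m _ _)

  sumL : ∀ {A : Set} → (A → ℕ) → List A → ℕ
  sumL f [] = 0
  sumL f (x ∷ xs) = f x + sumL f xs

  -- Each entry of the list is spread into a sum of Kronecker deltas; after exchanging the sums,
  -- distinctness leaves at most one delta at each index.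
  sum-≥-unique : ∀ {k} (f : Fin k → ℕ) {xs} → Unique xs → sumL f xs ≤ sumF f
  sum-≥-unique {k} f {xs} xs! = ≤-trans (≤-reflexive (spread xs)) (sum-mono (λ x → at-most x xs!))
    where
    at : Fin k → Fin k → ℕ
    at x y = if x == y then f x else 0
    spread : ∀ xs → sumL f xs ≡ sumF (λ x → sumL (at x) xs)
    spread [] = sym (sum-zero {k} λ _ → refl)
    spread (y ∷ xs) = trans (cong₂ _+_ (sym (sum-δ y f)) (spread xs)) (sym (sum-+ {k} _ _))
    none : ∀ x {xs} → All (x ≢_) xs → sumL (at x) xs ≡ 0
    none x [] = refl
    none x {y ∷ _} (x≢y ∷ x≢) rewrite ==-≢ x≢y = none x x≢
    at-most : ∀ x {xs} → Unique xs → sumL (at x) xs ≤ f x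
    at-most x [] = z≤n
    at-most x (_∷_ {y} y≢ xs!) with x F.≟ y
    ... | yes refl = ≤-reflexive (trans (cong (f x +_) (none x y≢)) (+-identityʳ (f x)))
    ... | no _ = at-most x xs!

  sum-≥₂ : ∀ {k} (f : Fin k → ℕ) {i j} → i ≢ j → f i + f j ≤ sumF f
  sum-≥₂ f {i} {j} i≢j = subst (λ z → f i + z ≤ sumF f) (+-identityʳ (f j))
    (sum-≥-unique f ((i≢j ∷ []) ∷ [] ∷ []))

  sum-++ : ∀ k {l} (f : Fin (k + l) → ℕ) →
           sumF f ≡ sumF (λ i → f (i ↑ˡ l)) + sumF (λ j → f (k ↑ʳ j))
  sum-++ zero f = refl
  sum-++ (suc k) f = trans (cong (f zero +_) (sum-++ k (λ i → f (suc i)))) (sym (+-assoc (f zero) _ _))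

  sum-combine : ∀ k {l} (f : Fin (k * l) → ℕ) → sumF f ≡ sumF (λ i → sumF (λ a → f (combine {k} {l} i a)))
  sum-combine zero f = refl
  sum-combine (suc k) {l} f = trans (sum-++ l f) (cong (sumF (λ i → f (i ↑ˡ (k * l))) +_) (sum-combine k {l} (λ j → f (l ↑ʳ j))))

  -- Double counting: `h (f i)` is written as a delta sum over `j`, and after the exchange the delta
  -- `j == f i` is read as `i == g j`.
  sum-permute : ∀ {k} (f g : Fin k → Fin k) → (∀ i → f (g i) ≡ i) → (∀ i → g (f i) ≡ i) →
                (h : Fin k → ℕ) → sumF (λ i → h (f i)) ≡ sumF h
  sum-permute {k} f g fg gf h = begin
    sumF (λ i → h (f i)) ≡⟨ sum-cong (λ i → sym (sum-δ (f i) h)) ⟩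
    sumF (λ i → sumF (λ j → if j == f i then h j else 0)) ≡⟨ sum-swap {k} {k} _ ⟩
    sumF (λ j → sumF (λ i → if j == f i then h j else 0)) ≡⟨ sum-cong (λ j → sum-cong λ i → cong (if_then h j else 0) (flip-== j i)) ⟩
    sumF (λ j → sumF (λ i → if i == g j then h j else 0)) ≡⟨ sum-cong (λ j → sum-δ (g j) (λ _ → h j)) ⟩
    sumF h ∎
    where
    open ≡-Reasoning
    flip-== : ∀ j i → (j == f i) ≡ (i == g j)
    flip-== j i with j F.≟ f i | i F.≟ g j
    ... | yes _ | yes _ = refl
    ... | no _ | no _ = refl
    ... | yes refl | no i≢ = contradiction (sym (gf i)) i≢
    ... | no j≢ | yes refl = contradiction (sym (fg j)) j≢

  -- `edgeCount` and `cutSize` look only at pairs with `i < j`, whereas everything below counts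
  -- ordered pairs. This is the passage between the two, for the edges of a graph as well as for the
  -- edges of a cut.
  handshake : ∀ {k} (r : Fin k → Fin k → Bool) → (∀ i j → r i j ≡ r j i) → (∀ i → r i i ≡ false) →
              sumF (λ i → count (r i)) ≡ 2 * sumF (λ i → count (λ j → r i j ∧ ⌊ i <? j ⌋))
  handshake {k} r r-sym r-irrefl = begin
    sumF (λ i → count (r i)) ≡⟨ sum-cong (λ i → trans (count≡sum (r i)) (trans (sum-cong (split i)) (sum-+ (up i) (λ j → up j i)))) ⟩
    sumF (λ i → sumF (up i) + sumF (λ j → up j i)) ≡⟨ sum-+ {k} _ _ ⟩
    sumF (λ i → sumF (up i)) + sumF (λ i → sumF (λ j → up j i)) ≡⟨ cong (ups +_) (sum-swap (λ i j → up j i)) ⟩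
    ups + ups ≡⟨ cong (ups +_) (sym (+-identityʳ ups)) ⟩
    2 * ups ≡⟨ cong (2 *_) (sum-cong (λ i → sym (count≡sum (λ j → r i j ∧ ⌊ i <? j ⌋)))) ⟩
    2 * sumF (λ i → count (λ j → r i j ∧ ⌊ i <? j ⌋)) ∎
    where
    open ≡-Reasoning
    up : Fin _ → Fin _ → ℕ
    up i j = ind (r i j ∧ ⌊ i <? j ⌋)
    ups = sumF (λ i → sumF (up i))
    split : ∀ i j → ind (r i j) ≡ up i j + up j i
    split i j rewrite r-sym j i with i <? j | j <? i
    ... | yes i<j | yes j<i = contradiction j<i (<-asym i<j)
    ... | yes _ | no _ with r i j
    ...   | true = refl
    ...   | false = refl
    split i j | no _ | yes _ with r i j
    ...   | true = refl
    ...   | false = refl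
    split i j | no i≮j | no j≮i with FP.<-cmp i j
    ...   | tri< i<j _ _ = contradiction i<j i≮j
    ...   | tri> _ _ j<i = contradiction j<i j≮i
    ...   | tri≈ _ refl _ rewrite r-irrefl i = refl

  sumL-cong : ∀ {A : Set} {f g : A → ℕ} → (∀ x → f x ≡ g x) → ∀ xs → sumL f xs ≡ sumL g xs
  sumL-cong f≗g [] = refl
  sumL-cong f≗g (x ∷ xs) = cong₂ _+_ (f≗g x) (sumL-cong f≗g xs)

  sumL-mono : ∀ {A : Set} {f g : A → ℕ} → (∀ x → f x ≤ g x) → ∀ xs → sumL f xs ≤ sumL g xs
  sumL-mono f≤g [] = z≤n
  sumL-mono f≤g (x ∷ xs) = +-mono-≤ (f≤g x) (sumL-mono f≤g xs)

  Arcs : ℕ → Set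
  Arcs k = List (Fin k × Fin k)

  mult : ∀ {k} → Arcs k → Fin k → Fin k → ℕ
  mult L a b = sumL (λ e → ind ((a == proj₁ e) ∧ (b == proj₂ e))) L

  -- The hypothesis says that `L` lists the relation without repetition. The indicator of `r` can
  -- then be replaced by the multiplicity in `L`, which is additive along the list.
  sum-arcs : ∀ {k} (L : Arcs k) (r : Fin k → Fin k → Bool) → (∀ a b → mult L a b ≡ ind (r a b)) →
             (g : Fin k → Fin k → Bool) →
             sumF (λ a → sumF (λ b → ind (r a b ∧ g a b))) ≡ sumL (λ e → ind (g (proj₁ e) (proj₂ e))) L
  sum-arcs {k} L r mult≡r g = trans
    (sum-cong λ a → sum-cong λ b → trans (ind-∧ (r a b) (g a b)) (cong (_* ind (g a b)) (sym (mult≡r a b))))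
    (weighted L)
    where
    ind-∧ : ∀ x y → ind (x ∧ y) ≡ ind x * ind y
    ind-∧ true y = sym (+-identityʳ _)
    ind-∧ false y = refl
    ind-if : ∀ x y n → ind (x ∧ y) * n ≡ (if x then (if y then n else 0) else 0)
    ind-if true true n = +-identityʳ n
    ind-if true false n = refl
    ind-if false _ n = refl
    weighted : ∀ L → sumF (λ a → sumF (λ b → mult L a b * ind (g a b))) ≡ sumL (λ e → ind (g (proj₁ e) (proj₂ e))) L
    weighted [] = sum-zero {k} λ a → sum-zero {k} λ b → refl
    weighted ((c , d) ∷ L) = begin
      sumF (λ a → sumF (λ b → (e a b + mult L a b) * ind (g a b)))
        ≡⟨ sum-cong (λ a → trans (sum-cong (λ b → *-distribʳ-+ (ind (g a b)) (e a b) (mult L a b))) (sum-+ {k} _ _)) ⟩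
      sumF (λ a → sumF (λ b → e a b * ind (g a b)) + sumF (λ b → mult L a b * ind (g a b)))
        ≡⟨ sum-+ {k} _ _ ⟩
      sumF (λ a → sumF (λ b → e a b * ind (g a b))) + sumF (λ a → sumF (λ b → mult L a b * ind (g a b)))
        ≡⟨ cong₂ _+_ single (weighted L) ⟩
      ind (g c d) + sumL (λ e → ind (g (proj₁ e) (proj₂ e))) L ∎
      where
      open ≡-Reasoning
      e : Fin _ → Fin _ → ℕ
      e a b = ind ((a == c) ∧ (b == d))
      single : sumF (λ a → sumF (λ b → e a b * ind (g a b))) ≡ ind (g c d)
      single = trans
        (sum-cong λ a → trans (sum-cong λ b → ind-if (a == c) (b == d) (ind (g a b)))
                       (trans (sum-if {k} (a == c) _) (cong (if a == c then_else 0) (sum-δ d (λ b → ind (g a b))))))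
        (sum-δ c (λ a → ind (g a d)))

-- Soundness of Boolean tests over finite sets and lists.

module BooleanChecks where

  open import Defs hiding (sym)
  open Sums
  open import Data.Bool using (Bool; true; false; T; _∧_; _∨_)
  open import Data.Bool.Properties using (∨-zeroʳ)
  open import Data.Fin using (Fin; zero; suc)
  open import Data.List using ([]; _∷_; _++_; map)
  open import Data.Bool.ListAction using (all; any)
  open import Data.List.Membership.Propositional using (_∈_)
  open import Data.List.Relation.Unary.Any using () renaming (here to hereᵃ; there to thereᵃ)
  open import Data.Nat
  open import Data.Nat.Properties hiding (_≟_)
  open import Data.Product using (_×_; _,_; ∃; proj₁; proj₂)
  open import Data.Sum using (inj₁; inj₂)
  open import Relation.Binary.PropositionalEquality

  all-∈ : ∀ {A : Set} (q : A → Bool) {xs} → all q xs ≡ true → ∀ {x} → x ∈ xs → q x ≡ true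
  all-∈ q e (hereᵃ refl) = proj₁ (∧-true e)
  all-∈ q {y ∷ _} e (thereᵃ x∈) = all-∈ q (proj₂ (∧-true {q y} e)) x∈

  any-∈ : ∀ {A : Set} (q : A → Bool) xs → any q xs ≡ true → ∃ λ x → x ∈ xs × q x ≡ true
  any-∈ q (x ∷ xs) e with ∨-true {q x} e
  ... | inj₁ qx = x , hereᵃ refl , qx
  ... | inj₂ e′ with any-∈ q xs e′
  ...   | y , y∈ , qy = y , thereᵃ y∈ , qy

  allF : ∀ {k} → (Fin k → Bool) → Bool
  allF {zero} q = true
  allF {suc k} q = q zero ∧ allF (λ i → q (suc i))

  allF-sound : ∀ {k} (q : Fin k → Bool) → allF q ≡ true → ∀ i → q i ≡ true
  allF-sound q e zero = proj₁ (∧-true e)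
  allF-sound q e (suc i) = allF-sound (λ j → q (suc j)) (proj₂ (∧-true {q zero} e)) i

  anyF : ∀ {k} → (Fin k → Bool) → Bool
  anyF {zero} q = false
  anyF {suc k} q = q zero ∨ anyF (λ i → q (suc i))

  anyF-sound : ∀ {k} (q : Fin k → Bool) → anyF q ≡ true → ∃ λ i → q i ≡ true
  anyF-sound {suc k} q e with ∨-true {q zero} e
  ... | inj₁ q0 = zero , q0
  ... | inj₂ e′ with anyF-sound (λ i → q (suc i)) e′
  ...   | i , qi = suc i , qi

  ≤ᵇ-sound : ∀ {m n} → (m ≤ᵇ n) ≡ true → m ≤ n
  ≤ᵇ-sound {m} {n} e = ≤ᵇ⇒≤ m n (subst (λ b → T b) (sym e) _)

  allF₂-sound : ∀ {k} (q : Fin k → Fin k → Bool) → allF (λ a → allF (q a)) ≡ true → ∀ a b → q a b ≡ true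
  allF₂-sound q e a = allF-sound (q a) (allF-sound (λ a → allF (q a)) e a)

  ≡ᵇ-sound : ∀ {m n} → (m ≡ᵇ n) ≡ true → m ≡ n
  ≡ᵇ-sound {m} {n} e = ≡ᵇ⇒≡ m n (subst T (sym e) _)

  arc? : ∀ {k} → Arcs k → Fin k → Fin k → Bool
  arc? L a b = any (λ e → (a == proj₁ e) ∧ (b == proj₂ e)) L

  arc?-∈ : ∀ {k} (L : Arcs k) {a b} → arc? L a b ≡ true → (a , b) ∈ L
  arc?-∈ L e with any-∈ _ L e
  ... | (c , d) , cd∈ , eq with ∧-true eq
  ...   | a≡ , b≡ = subst (_∈ L) (cong₂ _,_ (sym (==⇒≡ a≡)) (sym (==⇒≡ b≡))) cd∈

  ∈-arc? : ∀ {k} {L : Arcs k} {a b} → (a , b) ∈ L → arc? L a b ≡ true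
  ∈-arc? {a = a} {b} (hereᵃ refl) rewrite ==-refl a | ==-refl b = refl
  ∈-arc? {L = (c , d) ∷ L} {a} {b} (thereᵃ i) = trans (cong (((a == c) ∧ (b == d)) ∨_) (∈-arc? i)) (∨-zeroʳ _)

  sumL-++ : ∀ {A : Set} (f : A → ℕ) xs ys → sumL f (xs ++ ys) ≡ sumL f xs + sumL f ys
  sumL-++ f [] ys = refl
  sumL-++ f (x ∷ xs) ys = trans (cong (f x +_) (sumL-++ f xs ys)) (sym (+-assoc (f x) _ _))

  sumL-map : ∀ {A B : Set} (f : B → ℕ) (g : A → B) xs → sumL f (map g xs) ≡ sumL (λ x → f (g x)) xs
  sumL-map f g [] = refl
  sumL-map f g (x ∷ xs) = cong (f (g x) +_) (sumL-map f g xs)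

-- The building block of a ring and the finite facts required of it.

module Blocks where

  open import Defs hiding (sym)
  open Sums
  open BooleanChecks
  open import Data.Bool using (Bool; true; false; _∨_; _xor_)
  open import Data.Fin using (Fin; _↑ˡ_; _↑ʳ_)
  open import Data.Fin.Patterns
  open import Data.List using ([]; _∷_; _++_; map; allFin)
  open import Data.List.Membership.Propositional using (_∈_)
  open import Data.List.Membership.Propositional.Properties using (∈-++⁺ˡ; ∈-++⁺ʳ; ∈-++⁻; ∈-map⁻; ∈-map⁺; ∈-allFin)
  open import Data.List.Relation.Unary.Unique.Propositional using (Unique)
  open import Data.Nat
  open import Data.Product using (_×_; _,_; ∃; proj₁; proj₂; swap)
  open import Data.Sum using (_⊎_; inj₁; inj₂)
  open import Relation.Binary.PropositionalEquality

  -- A block of a ring: right e is to be joined to left e of the next block.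
  record Shape : Set where
    field
      size : ℕ
      edges : Arcs size
      right left : Fin 3 → Fin size

    Vertex : Set
    Vertex = Fin size

    darts links : Arcs size
    darts = edges ++ map swap edges
    links = map (λ e → right e , left e) (allFin 3)

    inner link : Vertex → Vertex → Bool
    inner = arc? darts
    link = arc? links

    edge-inner : ∀ {a b} → (a , b) ∈ edges → inner a b ≡ true
    edge-inner {a} {b} ab = ∈-arc? (∈-++⁺ˡ {v = a , b} {ys = map swap edges} ab)

    inner-edge : ∀ {a b} → inner a b ≡ true → (a , b) ∈ edges ⊎ (b , a) ∈ edges
    inner-edge {a} {b} e with ∈-++⁻ edges (arc?-∈ darts {a} {b} e)
    ... | inj₁ ab = inj₁ ab
    ... | inj₂ ba with ∈-map⁻ swap {xs = edges} ba
    ...   | _ , ba∈ , refl = inj₂ ba∈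

    edge-inner′ : ∀ {a b} → (a , b) ∈ edges → inner b a ≡ true
    edge-inner′ {a} {b} ab = ∈-arc? (∈-++⁺ʳ edges (∈-map⁺ swap ab))

    inner-sym : ∀ a b → inner a b ≡ inner b a
    inner-sym a b = true-iff (flip a b) (flip b a)
      where
      flip : ∀ a b → inner a b ≡ true → inner b a ≡ true
      flip a b e with inner-edge {a} {b} e
      ... | inj₁ ab = edge-inner′ ab
      ... | inj₂ ba = edge-inner ba

    link-ends : ∀ {a b} → link a b ≡ true → ∃ λ e → a ≡ right e × b ≡ left e
    link-ends {a} {b} l with ∈-map⁻ (λ e → right e , left e) {xs = allFin 3} (arc?-∈ links {a} {b} l)
    ... | e , _ , refl = e , refl , refl

    link-arc : ∀ e → link (right e) (left e) ≡ true
    link-arc e = ∈-arc? {L = links} (∈-map⁺ (λ e → right e , left e) (∈-allFin e))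

    -- The degree that a vertex has once its block stands in a ring; the last two sums are its links
    -- to the next block and from the previous one.
    valency : Vertex → ℕ
    valency a = sumF (λ b → ind (inner a b)) + (sumF (λ b → ind (link a b)) + sumF (λ b → ind (link b a)))

    innerCut : (Vertex → Bool) → ℕ
    innerCut f = sumL (λ e → ind (f (proj₁ e) xor f (proj₂ e))) edges

    linkCut : (Vertex → Bool) → (Vertex → Bool) → ℕ
    linkCut f g = sumL (λ e → ind (f (proj₁ e) xor g (proj₂ e))) links

    outerCut : (Vertex → Bool) → Bool → ℕ
    outerCut f w = sumF (λ e → ind (f (right e) xor w)) + sumF (λ e → ind (f (left e) xor w))

    record Star (f : Vertex → Bool) (w : Bool) (v : Vertex) : Set where
      field
        star-inner : ∀ {a b} → (a , b) ∈ edges → f a xor f b ≡ true → a ≡ v ⊎ b ≡ v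
        star-right : ∀ e → f (right e) xor w ≡ true → right e ≡ v
        star-left : ∀ e → f (left e) xor w ≡ true → left e ≡ v

    -- As in `Walk`, only the vertices entered are required to be kept. The target is a predicate
    -- because one use ends at a fixed root and the other at any attachment whose outer neighbour is
    -- kept.
    data Reach (f : Vertex → Bool) (S : Vertex → Set) : Vertex → Set where
      stop : ∀ {u} → S u → Reach f S u
      move : ∀ {u v} → inner u v ≡ true → f v ≡ false → Reach f S v → Reach f S u

    exit : Fin 6 → Vertex
    exit 0F = right 0F
    exit 1F = right 1F
    exit 2F = right 2F
    exit 3F = left 0F
    exit 4F = left 1F
    exit 5F = left 2F

    Exit : (Fin (size + 6) → Bool) → Vertex → Set
    Exit f u = ∃ λ e → exit e ≡ u × f (size ↑ʳ e) ≡ false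

  record Sturdy (B : Shape) : Set where
    open Shape B
    field
      inner-irrefl : ∀ a → inner a a ≡ false
      mult-darts : ∀ a b → mult darts a b ≡ ind (inner a b)
      mult-links : ∀ a b → mult links a b ≡ ind (link a b)
      right! : Unique (right 0F ∷ right 1F ∷ right 2F ∷ [])
      left! : Unique (left 0F ∷ left 1F ∷ left 2F ∷ [])
      valency≡4 : ∀ a → valency a ≡ 4
      innerCut-nonconstant : ∀ f → 3 ≤ innerCut f ⊎ ∃ λ c → ∀ a → f a ≡ c
      -- The outside of the block is contracted to a single vertex, which lies on side w of the cut.
      contracted-cut : ∀ f w → 6 ≤ innerCut f + outerCut f w ⊎ ∃ (Star f w)
      -- A ring of k blocks has k · size · 2 edges, hence a claw decomposition would have k · size · 4 / 6 centres.
      cover-size : ∀ f → (∀ {a b} → (a , b) ∈ edges → f a ∨ f b ≡ true) → size * 4 < count f * 6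
      -- The root `r` also witnesses that some vertex of the block is left.
      block-connected : ∀ f → 2 ≤ count f ⊎ ∃ λ r → f r ≡ false × (∀ a → f a ≡ false → Reach f (_≡ r) a)
      -- The last six arguments of f say whether the neighbour of an attachment vertex in the adjacent block is deleted.
      block-escape : ∀ f → 4 ≤ count f ⊎ (∀ a → f (a ↑ˡ 6) ≡ false → Reach (λ a → f (a ↑ˡ 6)) (Exit f) a)

-- Cyclic order, the ring of blocks, its degrees and its number of edges.

module Necklaces where

  open import Defs hiding (sym)
  open Sums
  open Blocks
  open import Data.Bool using (Bool; true; false; if_then_else_; _∧_; _∨_)
  open import Data.Bool.Properties using (∧-identityʳ; ∨-zeroʳ)
  open import Data.Fin using (Fin; zero; suc; toℕ; fromℕ; inject₁; combine; remQuot)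
  open import Data.Fin.Relation.Unary.Top using (view; ‵fromℕ; ‵inject₁; view-fromℕ; view-inject₁)
  import Data.Fin as F
  import Data.Fin.Properties as FP
  open import Data.Fin.Induction using (<-weakInduction)
  open import Data.Nat hiding (_<?_)
  open import Data.Nat.Properties hiding (_<?_; _≟_)
  open import Data.Product using (_×_; _,_; proj₁; proj₂; uncurry)
  open import Data.Sum using (inj₁; inj₂)
  open import Relation.Nullary using (yes; no; contradiction)
  open import Relation.Binary.PropositionalEquality

  rotate unrotate : ∀ {n} → Fin (suc n) → Fin (suc n)
  rotate i with view i
  ... | ‵fromℕ = zero
  ... | ‵inject₁ j = suc j
  unrotate zero = fromℕ _
  unrotate (suc j) = inject₁ j

  rotate-fromℕ : ∀ n → rotate (fromℕ n) ≡ zero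
  rotate-fromℕ n rewrite view-fromℕ n = refl

  rotate-inject₁ : ∀ {n} (j : Fin n) → rotate (inject₁ j) ≡ suc j
  rotate-inject₁ j rewrite view-inject₁ j = refl

  rotate-unrotate : ∀ {n} (i : Fin (suc n)) → rotate (unrotate i) ≡ i
  rotate-unrotate zero = rotate-fromℕ _
  rotate-unrotate (suc j) = rotate-inject₁ j

  unrotate-rotate : ∀ {n} (i : Fin (suc n)) → unrotate (rotate i) ≡ i
  unrotate-rotate i with view i
  ... | ‵fromℕ = refl
  ... | ‵inject₁ j = refl

  rotate≢ : ∀ {n} (i : Fin (suc (suc n))) → rotate i ≢ i
  rotate≢ i e with view i
  ... | ‵inject₁ j = <⇒≢ (n<1+n (toℕ j)) (sym (trans (cong toℕ e) (FP.toℕ-inject₁ j)))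

  -- With at least three positions the successor and the predecessor differ. In the ring this makes
  -- the two neighbouring blocks of a block distinct.
  rotate²≢ : ∀ {n} (i : Fin (suc (suc (suc n)))) → rotate (rotate i) ≢ i
  rotate²≢ i e = rotate≢unrotate i (trans (sym (unrotate-rotate (rotate i))) (cong unrotate e))
    where
    rotate≢unrotate : ∀ {n} (i : Fin (suc (suc (suc n)))) → rotate i ≢ unrotate i
    rotate≢unrotate {n} zero e with () ← e
    rotate≢unrotate (suc i) e with view i
    ... | ‵inject₁ j = <⇒≢ (m<n⇒m<1+n (n<1+n (toℕ j)))
      (sym (trans (cong toℕ e) (trans (FP.toℕ-inject₁ (inject₁ j)) (FP.toℕ-inject₁ j))))

  -- Induction once around the ring, from the position after `i` back to `i`, so that no step leaves
  -- `i`: ordinary induction above `i`, the passage from the last position to zero, then ordinary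
  -- induction up to `i`.
  module _ {n} (P : Fin (suc n) → Set) (i : Fin (suc n)) (base : P (rotate i)) (step : ∀ j → j ≢ i → P j → P (rotate j)) where

    private
      above : ∀ j → toℕ i < toℕ j → P j
      above = <-weakInduction (λ j → toℕ i < toℕ j → P j) (λ ()) up
        where
        up : ∀ j → (toℕ i < toℕ (inject₁ j) → P (inject₁ j)) → toℕ i < suc (toℕ j) → P (suc j)
        up j ih i≤j with inject₁ j F.≟ i
        ... | yes refl = subst P (rotate-inject₁ j) base
        ... | no j≢i = subst P (rotate-inject₁ j) (step (inject₁ j) j≢i (ih (≤∧≢⇒< i≤j′ λ e → j≢i (sym (FP.toℕ-injective e)))))
          where i≤j′ = subst (toℕ i ≤_) (sym (FP.toℕ-inject₁ j)) (s≤s⁻¹ i≤j)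

      wrap : P zero
      wrap with fromℕ n F.≟ i
      ... | yes refl = subst P (rotate-fromℕ n) base
      ... | no n≢i = subst P (rotate-fromℕ n) (step (fromℕ n) n≢i (above (fromℕ n)
        (≤∧≢⇒< (FP.≤fromℕ i) λ e → n≢i (sym (FP.toℕ-injective e)))))

      below : ∀ j → toℕ j ≤ toℕ i → P j
      below = <-weakInduction (λ j → toℕ j ≤ toℕ i → P j) (λ _ → wrap) λ j ih j<i →
        subst P (rotate-inject₁ j) (step (inject₁ j)
          (λ e → <⇒≢ j<i (trans (sym (FP.toℕ-inject₁ j)) (cong toℕ e)))
          (ih (subst (_≤ toℕ i) (sym (FP.toℕ-inject₁ j)) (<⇒≤ j<i))))

    ring-induction : ∀ j → P j
    ring-induction j with ≤-<-connex (toℕ j) (toℕ i)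
    ... | inj₁ j≤i = below j j≤i
    ... | inj₂ i<j = above j i<j

  -- Counting and connectivity see the ring only through this interface, free of arithmetic; the
  -- drawing alone returns to numerical positions.
  record Cyclic (k : ℕ) : Set₁ where
    field
      next prev : Fin k → Fin k
      next-prev : ∀ i → next (prev i) ≡ i
      prev-next : ∀ i → prev (next i) ≡ i
      next≢ : ∀ i → next i ≢ i
      next²≢ : ∀ i → next (next i) ≢ i
      induction : (P : Fin k → Set) → ∀ i → P (next i) → (∀ j → j ≢ i → P j → P (next j)) → ∀ j → P j

  cyclic : ∀ m → Cyclic (3 + m)
  cyclic m = record
    { next = rotate ; prev = unrotate ; next-prev = rotate-unrotate ; prev-next = unrotate-rotate
    ; next≢ = rotate≢ ; next²≢ = rotate²≢ ; induction = ring-induction }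

  module Necklace {k} (C : Cyclic k) (B : Shape) (good : Sturdy B) where

    open Cyclic C
    open Shape B
    open Sturdy good

    Place : Set
    Place = Fin k × Vertex

    adjacent : Place → Place → Bool
    adjacent (i , a) (j , b) = ((j == i) ∧ inner a b) ∨ (((j == next i) ∧ link a b) ∨ ((j == prev i) ∧ link b a))

    -- `back` starts at `next i` instead of ending at `prev i`, so that reversing a link only
    -- exchanges two constructors, without a transport along `next-prev`.
    data Adjacent : Place → Place → Set where
      inside : ∀ {i a b} → inner a b ≡ true → Adjacent (i , a) (i , b)
      forth : ∀ i e → Adjacent (i , right e) (next i , left e)
      back : ∀ i e → Adjacent (next i , left e) (i , right e)

    back-prev : ∀ i e → Adjacent (i , left e) (prev i , right e)
    back-prev i e = subst (λ i′ → Adjacent (i′ , left e) (prev i , right e)) (next-prev i) (back (prev i) e)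

    adjacent⇒ : ∀ {p q} → adjacent p q ≡ true → Adjacent p q
    adjacent⇒ {i , a} {j , b} e with ∨-true {(j == i) ∧ inner a b} e
    ... | inj₁ x with ∧-true {j == i} x
    ...   | j≡i , ab with refl ← ==⇒≡ j≡i = inside ab
    adjacent⇒ {i , a} {j , b} e | inj₂ x with ∨-true {(j == next i) ∧ link a b} x
    ... | inj₁ y with ∧-true {j == next i} y
    ...   | j≡ , ab with refl ← ==⇒≡ j≡ | link-ends {a} {b} ab
    ...     | e , refl , refl = forth i e
    adjacent⇒ {i , a} {j , b} e | inj₂ x | inj₂ y with ∧-true {j == prev i} y
    ...   | j≡ , ba with refl ← ==⇒≡ j≡ | link-ends {b} {a} ba
    ...     | e , refl , refl = back-prev i e

    ⇒adjacent : ∀ {p q} → Adjacent p q → adjacent p q ≡ true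
    ⇒adjacent {i , a} (inside ab) rewrite ==-refl i | ab = refl
    ⇒adjacent (forth i e) rewrite ==-refl (next i) | link-arc e = ∨-zeroʳ _
    ⇒adjacent (back i e) rewrite prev-next i | ==-refl i | link-arc e =
      trans (cong (((i == next i) ∧ inner (left e) (right e)) ∨_) (∨-zeroʳ ((i == next (next i)) ∧ link (left e) (right e)))) (∨-zeroʳ _)

    Adjacent-sym : ∀ {p q} → Adjacent p q → Adjacent q p
    Adjacent-sym (inside {a = a} {b} ab) = inside (trans (inner-sym b a) ab)
    Adjacent-sym (forth i e) = back i e
    Adjacent-sym (back i e) = forth i e

    adjacent-sym : ∀ p q → adjacent p q ≡ adjacent q p
    adjacent-sym p q = true-iff (flip p q) (flip q p)
      where
      flip : ∀ p q → adjacent p q ≡ true → adjacent q p ≡ true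
      flip p q e = ⇒adjacent (Adjacent-sym (adjacent⇒ {p} {q} e))

    adjacent-irrefl : ∀ p → adjacent p p ≡ false
    adjacent-irrefl (i , a) rewrite ==-refl i | inner-irrefl a
      | ==-≢ {i = i} {next i} (λ e → next≢ i (sym e))
      | ==-≢ {i = i} {prev i} (λ e → next≢ i (trans (cong next e) (next-prev i))) = refl

    V : Set
    V = Fin (k * size)

    loc : V → Place
    loc = remQuot size

    ⟨_,_⟩ : Fin k → Vertex → V
    ⟨ i , a ⟩ = combine i a

    loc-⟨⟩ : ∀ i a → loc ⟨ i , a ⟩ ≡ (i , a)
    loc-⟨⟩ = FP.remQuot-combine

    ⟨⟩-loc : ∀ x → uncurry ⟨_,_⟩ (loc x) ≡ x
    ⟨⟩-loc = FP.combine-remQuot {k} size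

    necklace : Graph
    necklace = record
      { n = k * size
      ; adj = λ x y → adjacent (loc x) (loc y)
      ; sym = λ x y → adjacent-sym (loc x) (loc y)
      ; irrefl = λ x → adjacent-irrefl (loc x)
      }

    adj-⟨⟩ : ∀ i a j b → adj necklace ⟨ i , a ⟩ ⟨ j , b ⟩ ≡ adjacent (i , a) (j , b)
    adj-⟨⟩ i a j b = cong₂ adjacent (loc-⟨⟩ i a) (loc-⟨⟩ j b)

    sum-places : (f : V → ℕ) → sumF f ≡ sumF (λ i → sumF (λ a → f ⟨ i , a ⟩))
    sum-places = sum-combine k {size}

    -- The blocks `i`, `next i` and `prev i` are distinct, so at most one alternative of `adjacent`
    -- is possible for each `j`. The disjunctions thus become sums, and `sum-δ` selects the three
    -- blocks. Constant `g` gives degrees; comparison of sides gives cuts.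
    sum-neighbours : ∀ i a (g : V → Bool) →
      sumF (λ y → ind (adj necklace ⟨ i , a ⟩ y ∧ g y)) ≡
      sumF (λ b → ind (inner a b ∧ g ⟨ i , b ⟩)) +
      (sumF (λ b → ind (link a b ∧ g ⟨ next i , b ⟩)) + sumF (λ b → ind (link b a ∧ g ⟨ prev i , b ⟩)))
    sum-neighbours i a g = begin
      sumF (λ y → ind (adj necklace ⟨ i , a ⟩ y ∧ g y))
        ≡⟨ sum-places _ ⟩
      sumF (λ j → sumF (λ b → ind (adj necklace ⟨ i , a ⟩ ⟨ j , b ⟩ ∧ g ⟨ j , b ⟩)))
        ≡⟨ sum-cong (λ j → trans (sum-cong λ b → trans (cong (λ z → ind (z ∧ g ⟨ j , b ⟩)) (adj-⟨⟩ i a j b)) (pointwise j b))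
           (sum-if₃ {size} (j == i) (j == next i) (j == prev i) (λ b → ind (inner a b ∧ g ⟨ j , b ⟩)) (λ b → ind (link a b ∧ g ⟨ j , b ⟩)) (λ b → ind (link b a ∧ g ⟨ j , b ⟩)))) ⟩
      sumF (λ j → (if j == i then I j else 0) + ((if j == next i then N j else 0) + (if j == prev i then Q j else 0)))
        ≡⟨ trans (sum-+ {k} _ _) (cong (sumF (λ j → if j == i then I j else 0) +_) (sum-+ {k} _ _)) ⟩
      sumF (λ j → if j == i then I j else 0) + (sumF (λ j → if j == next i then N j else 0) + sumF (λ j → if j == prev i then Q j else 0))
        ≡⟨ cong₂ _+_ (sum-δ i I) (cong₂ _+_ (sum-δ (next i) N) (sum-δ (prev i) Q)) ⟩
      I i + (N (next i) + Q (prev i)) ∎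
      where
      open ≡-Reasoning
      I N Q : Fin k → ℕ
      I j = sumF (λ b → ind (inner a b ∧ g ⟨ j , b ⟩))
      N j = sumF (λ b → ind (link a b ∧ g ⟨ j , b ⟩))
      Q j = sumF (λ b → ind (link b a ∧ g ⟨ j , b ⟩))
      pointwise : ∀ j b → ind (adjacent (i , a) (j , b) ∧ g ⟨ j , b ⟩) ≡
        (if j == i then ind (inner a b ∧ g ⟨ j , b ⟩) else 0) +
        ((if j == next i then ind (link a b ∧ g ⟨ j , b ⟩) else 0) + (if j == prev i then ind (link b a ∧ g ⟨ j , b ⟩) else 0))
      pointwise j b with j F.≟ i | j F.≟ next i | j F.≟ prev i
      ... | yes refl | yes e | _ = contradiction (sym e) (next≢ i)
      ... | yes refl | no _ | yes e = contradiction (trans (cong next e) (next-prev i)) (next≢ i)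
      ... | no _ | yes refl | yes e = contradiction (trans (cong next e) (next-prev i)) (next²≢ i)
      ... | yes _ | no _ | no _ with inner a b
      ...   | true = sym (+-identityʳ _)
      ...   | false = refl
      pointwise j b | no _ | yes _ | no _ with link a b
      ...   | true = sym (+-identityʳ _)
      ...   | false = refl
      pointwise j b | no _ | no _ | yes _ = refl
      pointwise j b | no _ | no _ | no _ = refl

    regular : Regular 4 necklace
    regular x = subst (λ x → degree necklace x ≡ 4) (⟨⟩-loc x) (at (proj₁ (loc x)) (proj₂ (loc x)))
      where
      open ≡-Reasoning
      at : ∀ i a → degree necklace ⟨ i , a ⟩ ≡ 4
      at i a = begin
        count (adj necklace ⟨ i , a ⟩)
          ≡⟨ trans (count≡sum (adj necklace ⟨ i , a ⟩)) (sum-cong λ y → cong ind (sym (∧-identityʳ (adj necklace ⟨ i , a ⟩ y)))) ⟩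
        sumF (λ y → ind (adj necklace ⟨ i , a ⟩ y ∧ true))
          ≡⟨ sum-neighbours i a (λ _ → true) ⟩
        sumF (λ b → ind (inner a b ∧ true)) + (sumF (λ b → ind (link a b ∧ true)) + sumF (λ b → ind (link b a ∧ true)))
          ≡⟨ cong₂ _+_ (drop (inner a)) (cong₂ _+_ (drop (link a)) (drop (λ b → link b a))) ⟩
        valency a
          ≡⟨ valency≡4 a ⟩
        4 ∎
        where
        drop : (f : Vertex → Bool) → sumF (λ b → ind (f b ∧ true)) ≡ sumF (λ b → ind (f b))
        drop f = sum-cong λ b → cong ind (∧-identityʳ (f b))

    edge-total : sumF (degree necklace) ≡ 2 * edgeCount necklace
    edge-total = handshake (adj necklace) (Graph.sym necklace) (irrefl necklace)

    degree-total : sumF (degree necklace) ≡ (k * size) * 4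
    degree-total = trans (sum-cong regular) (sum-const (k * size) 4)

    edgeCount≡ : edgeCount necklace ≡ k * (size * 2)
    edgeCount≡ = *-cancelˡ-≡ _ _ 2 (begin
      2 * edgeCount necklace ≡⟨ edge-total ⟨
      sumF (degree necklace) ≡⟨ degree-total ⟩
      k * size * 4 ≡⟨ *-assoc (k * size) 2 2 ⟨
      k * size * 2 * 2 ≡⟨ *-comm (k * size * 2) 2 ⟩
      2 * (k * size * 2) ≡⟨ cong (2 *_) (*-assoc k size 2) ⟩
      2 * (k * (size * 2)) ∎)
      where open ≡-Reasoning

-- Centres of claws as a vertex cover, and the count that excludes a decomposition.

module ClawDecompositions where

  open import Defs hiding (sym)
  open Sums
  open Blocks
  open Necklaces
  open import Data.Bool using (Bool; true; false; if_then_else_; _∧_; _∨_)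
  open import Data.Bool.Properties using (∨-zeroʳ)
  open import Data.Fin using (Fin; suc)
  open import Data.List using (List; []; _∷_; length)
  open import Data.List.Relation.Unary.All using ([]; _∷_)
  open import Data.List.Relation.Unary.AllPairs using ([]; _∷_)
  open import Data.List.Relation.Unary.Unique.Propositional using (Unique)
  open import Data.List.Membership.Propositional using (_∈_)
  open import Data.Nat hiding (_<?_)
  open import Data.Nat.Properties hiding (_<?_; _≟_)
  open import Data.Product using (_×_; _,_; proj₁; proj₂)
  open import Data.Sum using (_⊎_; inj₁; inj₂)
  open import Relation.Nullary using (¬_; contradiction)
  open import Relation.Binary.PropositionalEquality

  module _ (G : Graph) where

    isCentre : List (Claw G) → Fin (n G) → Bool
    isCentre [] v = false
    isCentre (K ∷ Ks) v = (v == Claw.c K) ∨ isCentre Ks v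

    centres≤claws : ∀ Ks → count (isCentre Ks) ≤ length Ks
    centres≤claws Ks = ≤-trans (≤-reflexive (count≡sum (isCentre Ks))) (bound Ks)
      where
      open ≤-Reasoning
      ind-∨ : ∀ x y → ind (x ∨ y) ≤ (if x then 1 else 0) + ind y
      ind-∨ true y = s≤s z≤n
      ind-∨ false y = ≤-refl
      bound : ∀ Ks → sumF (λ v → ind (isCentre Ks v)) ≤ length Ks
      bound [] = ≤-reflexive (sum-zero {n G} λ _ → refl)
      bound (K ∷ Ks) = begin
        sumF (λ v → ind ((v == Claw.c K) ∨ isCentre Ks v)) ≤⟨ sum-mono (λ v → ind-∨ (v == Claw.c K) (isCentre Ks v)) ⟩
        sumF (λ v → (if v == Claw.c K then 1 else 0) + ind (isCentre Ks v)) ≡⟨ sum-+ {n G} _ _ ⟩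
        sumF (λ v → if v == Claw.c K then 1 else 0) + sumF (λ v → ind (isCentre Ks v))
          ≤⟨ +-mono-≤ (≤-reflexive (sum-δ (Claw.c K) (λ _ → 1))) (bound Ks) ⟩
        suc (length Ks) ∎

    adj-≢ : ∀ {u v} → adj G u v ≡ true → u ≢ v
    adj-≢ {u} uv refl with () ← trans (sym uv) (irrefl G u)

    inClaw⇒ : ∀ K {i j} → inClaw {G} K i j ≡ true → adj G i j ≡ true × (i ≡ Claw.c K ⊎ j ≡ Claw.c K)
    inClaw⇒ K {i} {j} e with ∨-true {(i == Claw.c K) ∧ _} e
    ... | inj₁ x with ∧-true {i == Claw.c K} x
    ...   | i≡c , y with refl ← ==⇒≡ i≡c = leaf y , inj₁ refl
      where
      leaf : (j == Claw.a K) ∨ ((j == Claw.b K) ∨ (j == Claw.d K)) ≡ true → adj G (Claw.c K) j ≡ true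
      leaf y with ∨-true {j == Claw.a K} y
      ... | inj₁ ja with refl ← ==⇒≡ ja = Claw.ca K
      ... | inj₂ z with ∨-true {j == Claw.b K} z
      ...   | inj₁ jb with refl ← ==⇒≡ jb = Claw.cb K
      ...   | inj₂ jd with refl ← ==⇒≡ jd = Claw.cd K
    inClaw⇒ K {i} {j} e | inj₂ x with ∧-true {j == Claw.c K} x
    ...   | j≡c , y with refl ← ==⇒≡ j≡c = trans (Graph.sym G i (Claw.c K)) (leaf y) , inj₂ refl
      where
      leaf : (i == Claw.a K) ∨ ((i == Claw.b K) ∨ (i == Claw.d K)) ≡ true → adj G (Claw.c K) i ≡ true
      leaf y with ∨-true {i == Claw.a K} y
      ... | inj₁ ia with refl ← ==⇒≡ ia = Claw.ca K
      ... | inj₂ z with ∨-true {i == Claw.b K} z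
      ...   | inj₁ ib with refl ← ==⇒≡ ib = Claw.cb K
      ...   | inj₂ id with refl ← ==⇒≡ id = Claw.cd K

    covered⇒centre : ∀ Ks {i j} → countClaws Ks i j ≢ 0 → isCentre Ks i ∨ isCentre Ks j ≡ true
    covered⇒centre [] ≢0 = contradiction refl ≢0
    covered⇒centre (K ∷ Ks) {i} {j} ≢0 with inClaw K i j in e
    ... | false = widen {isCentre Ks i} {isCentre Ks j} {i == Claw.c K} {j == Claw.c K} (covered⇒centre Ks ≢0)
      where
      widen : ∀ {x y x′ y′} → x ∨ y ≡ true → (x′ ∨ x) ∨ (y′ ∨ y) ≡ true
      widen {true} {y} {x′} {y′} _ rewrite ∨-zeroʳ x′ = refl
      widen {false} {true} {x′} {y′} _ rewrite ∨-zeroʳ y′ = ∨-zeroʳ _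
    ... | true with proj₂ (inClaw⇒ K {i} {j} e)
    ...   | inj₁ refl rewrite ==-refl i = refl
    ...   | inj₂ refl rewrite ==-refl j = ∨-zeroʳ _

    -- Three ordered pairs start at the centre and one at each leaf. The four rows are different
    -- because the leaves are distinct and adjacency is irreflexive.
    claw-arcs : ∀ K → 6 ≤ sumF (λ i → sumF (λ j → ind (inClaw {G} K i j)))
    claw-arcs K = ≤-trans (+-mono-≤ row-c (+-mono-≤ (row-leaf to-a) (+-mono-≤ (row-leaf to-b) (+-monoˡ-≤ 0 (row-leaf to-d)))))
      (sum-≥-unique row ((adj-≢ (ca) ∷ adj-≢ cb ∷ adj-≢ cd ∷ []) ∷ leaves))
      where
      open Claw K
      row : Fin (n G) → ℕ
      row i = sumF (λ j → ind (inClaw K i j))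
      leaves : Unique (a ∷ b ∷ d ∷ [])
      leaves = (a≢b ∷ a≢d ∷ []) ∷ (b≢d ∷ []) ∷ [] ∷ []
      from-c : ∀ {j} → (j == a) ∨ ((j == b) ∨ (j == d)) ≡ true → inClaw K c j ≡ true
      from-c e rewrite ==-refl c | e = refl
      to-c : ∀ {i} → (i == a) ∨ ((i == b) ∨ (i == d)) ≡ true → inClaw K i c ≡ true
      to-c e rewrite ==-refl c | e = ∨-zeroʳ _
      to-a : (a == a) ∨ ((a == b) ∨ (a == d)) ≡ true
      to-a rewrite ==-refl a = refl
      to-b : (b == a) ∨ ((b == b) ∨ (b == d)) ≡ true
      to-b rewrite ==-refl b = ∨-zeroʳ _
      to-d : (d == a) ∨ ((d == b) ∨ (d == d)) ≡ true
      to-d rewrite ==-refl d | ∨-zeroʳ (d == b) = ∨-zeroʳ _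
      row-c : 3 ≤ row c
      row-c = ≤-trans (≤-reflexive (cong₂ _+_ (one to-a) (cong₂ _+_ (one to-b) (cong₂ _+_ (one to-d) (refl {x = 0})))))
        (sum-≥-unique (λ j → ind (inClaw K c j)) leaves)
        where
        one : ∀ {j} → (j == a) ∨ ((j == b) ∨ (j == d)) ≡ true → 1 ≡ ind (inClaw K c j)
        one e = sym (cong ind (from-c e))
      row-leaf : ∀ {i} → (i == a) ∨ ((i == b) ∨ (i == d)) ≡ true → 1 ≤ row i
      row-leaf {i} e = ≤-trans (≤-reflexive (sym (cong ind (to-c e)))) (sum-≥₁ (λ j → ind (inClaw K i j)) c)

    claws≤arcs : ∀ Ks → length Ks * 6 ≤ sumF (λ i → sumF (countClaws Ks i))
    claws≤arcs [] = z≤n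
    claws≤arcs (K ∷ Ks) = ≤-trans (+-mono-≤ (claw-arcs K) (claws≤arcs Ks)) (≤-reflexive (sym
      (trans (sum-cong λ i → sum-+ (λ j → ind (inClaw K i j)) (countClaws Ks i)) (sum-+ {n G} _ _))))

    -- A claw consists of edges, so a nonadjacent pair is counted zero times, and an adjacent one
    -- exactly once by hypothesis.
    arcs≤degrees : ∀ Ks → (∀ i j → adj G i j ≡ true → countClaws Ks i j ≡ 1) →
                   sumF (λ i → sumF (countClaws Ks i)) ≤ sumF (degree G)
    arcs≤degrees Ks exact = sum-mono λ i → ≤-trans (sum-mono (pointwise i)) (≤-reflexive (sym (count≡sum (adj G i))))
      where
      outside : ∀ Ks {i j} → adj G i j ≡ false → countClaws Ks i j ≡ 0
      outside [] _ = refl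
      outside (K ∷ Ks) {i} {j} ij with inClaw K i j in e
      ... | false = outside Ks ij
      ... | true with () ← trans (sym (proj₁ (inClaw⇒ K {i} {j} e))) ij
      pointwise : ∀ i j → countClaws Ks i j ≤ ind (adj G i j)
      pointwise i j with adj G i j in ij
      ... | true = ≤-reflexive (exact i j ij)
      ... | false = ≤-reflexive (outside Ks ij)

  module _ {k} (C : Cyclic k) (B : Shape) (good : Sturdy B) where
    open Shape B
    open Sturdy good
    open Necklace C B good

    -- Everything is multiplied by six, the number of ordered pairs in a claw, which avoids the
    -- fraction 2/3. The cover is estimated block by block from the inner edges alone, without the
    -- links.
    no-claw-decomposition : 0 < k → ¬ ClawDecomposition necklace
    no-claw-decomposition 0<k (Ks , exact) = n≮n (sumF (degree necklace)) (begin-strict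
      sumF (degree necklace) ≡⟨ degree-total ⟩
      k * size * 4 ≡⟨ *-assoc k size 4 ⟩
      k * (size * 4) <⟨ many-centres ⟩
      count centre * 6 ≤⟨ *-monoˡ-≤ 6 (centres≤claws necklace Ks) ⟩
      length Ks * 6 ≤⟨ claws≤arcs necklace Ks ⟩
      sumF (λ i → sumF (countClaws Ks i)) ≤⟨ arcs≤degrees necklace Ks exact ⟩
      sumF (degree necklace) ∎)
      where
      open ≤-Reasoning
      centre : V → Bool
      centre = isCentre necklace Ks
      cover : ∀ i {a b} → (a , b) ∈ edges → centre ⟨ i , a ⟩ ∨ centre ⟨ i , b ⟩ ≡ true
      cover i {a} {b} ab = covered⇒centre necklace Ks λ e →
        contradiction (trans (sym e) (exact ⟨ i , a ⟩ ⟨ i , b ⟩ (trans (adj-⟨⟩ i a i b) (⇒adjacent {i , a} {i , b} (inside (edge-inner ab)))))) λ ()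
      covering : Fin k → ℕ
      covering i = count (λ a → centre ⟨ i , a ⟩)
      many-centres : k * (size * 4) < count centre * 6
      many-centres = begin-strict
        -- Every block exceeds its share by at least one, and there is at least one block.
        k * (size * 4) <⟨ *-monoʳ-< k {{>-nonZero 0<k}} (n<1+n (size * 4)) ⟩
        k * suc (size * 4) ≡⟨ sum-const k (suc (size * 4)) ⟨
        sumF {k} (λ _ → suc (size * 4)) ≤⟨ sum-mono {k} (λ i → cover-size (λ a → centre ⟨ i , a ⟩) (cover i)) ⟩
        sumF (λ i → covering i * 6) ≡⟨ sum-*ʳ covering 6 ⟩
        sumF covering * 6 ≡⟨ cong (_* 6) (sum-cong λ i → count≡sum (λ a → centre ⟨ i , a ⟩)) ⟩
        sumF (λ i → sumF (λ a → ind (centre ⟨ i , a ⟩))) * 6 ≡⟨ cong (_* 6) (sum-places (λ x → ind (centre x))) ⟨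
        sumF (λ x → ind (centre x)) * 6 ≡⟨ cong (_* 6) (count≡sum centre) ⟨
        count centre * 6 ∎

-- Essential 6-edge-connectivity of the ring.

module EdgeCuts where

  open import Defs hiding (sym)
  open Sums
  open BooleanChecks
  open Blocks
  open Necklaces
  open import Data.Bool using (Bool; true; false; _∧_; _xor_)
  open import Data.Bool.Properties using (∧-assoc; ∧-comm; xor-comm; xor-same)
  open import Data.Empty using (⊥; ⊥-elim)
  open import Data.Fin using (Fin; _<?_)
  import Data.Fin as F
  import Data.Fin.Properties as FP
  open import Data.List using (map)
  open import Data.Nat hiding (_<?_)
  open import Data.Nat.Properties hiding (_<?_; _≟_)
  open import Data.Product using (_×_; _,_; ∃; proj₁; proj₂; swap; uncurry)
  open import Data.Sum using (_⊎_; inj₁; inj₂)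
  import Data.Sum as Sum
  open import Relation.Nullary using (yes; no; contradiction)
  open import Relation.Nullary.Decidable using (⌊_⌋; _×-dec_; ¬?)
  open import Relation.Binary.PropositionalEquality

  module Cuts (B : Shape) (good : Sturdy B) where
    open Shape B
    open Sturdy good

    sum-inner : ∀ f → sumF (λ a → sumF (λ b → ind (inner a b ∧ (f a xor f b)))) ≡ innerCut f + innerCut f
    sum-inner f = begin
      sumF (λ a → sumF (λ b → ind (inner a b ∧ (f a xor f b)))) ≡⟨ sum-arcs darts inner mult-darts (λ a b → f a xor f b) ⟩
      sumL h darts ≡⟨ sumL-++ h edges (map swap edges) ⟩
      innerCut f + sumL h (map swap edges) ≡⟨ cong (innerCut f +_) (sumL-map h swap edges) ⟩
      innerCut f + sumL (λ e → h (swap e)) edges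
        ≡⟨ cong (innerCut f +_) (sumL-cong (λ e → cong ind (xor-comm (f (proj₂ e)) (f (proj₁ e)))) edges) ⟩
      innerCut f + innerCut f ∎
      where
      open ≡-Reasoning
      h : Vertex × Vertex → ℕ
      h e = ind (f (proj₁ e) xor f (proj₂ e))

    sum-link : ∀ f g → sumF (λ a → sumF (λ b → ind (link a b ∧ (f a xor g b)))) ≡ linkCut f g
    sum-link f g = sum-arcs links link mult-links (λ a b → f a xor g b)

    sum-link-back : ∀ f g → sumF (λ a → sumF (λ b → ind (link b a ∧ (f a xor g b)))) ≡ linkCut g f
    sum-link-back f g = begin
      sumF (λ a → sumF (λ b → ind (link b a ∧ (f a xor g b)))) ≡⟨ sum-swap {size} {size} (λ a b → ind (link b a ∧ (f a xor g b))) ⟩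
      sumF (λ b → sumF (λ a → ind (link b a ∧ (f a xor g b))))
        ≡⟨ sum-cong {size} (λ b → sum-cong {size} λ a → cong (λ z → ind (link b a ∧ z)) (xor-comm (f a) (g b))) ⟩
      sumF (λ b → sumF (λ a → ind (link b a ∧ (g b xor f a)))) ≡⟨ sum-link g f ⟩
      linkCut g f ∎
      where open ≡-Reasoning

    linkCut-constant : ∀ {f g c d} → (∀ a → f a ≡ c) → (∀ a → g a ≡ d) → c ≢ d → 3 ≤ linkCut f g
    linkCut-constant {f} {g} {c} {d} f≡c g≡d c≢d = subst (λ z → sumF {3} (λ _ → z) ≤ linkCut f g) (differs c≢d)
      (sum-mono {3} λ e → ≤-reflexive (sym (cong₂ (λ x y → ind (x xor y)) (f≡c (right e)) (g≡d (left e)))))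
      where
      differs : ∀ {c d} → c ≢ d → ind (c xor d) ≡ 1
      differs {true} {true} ne = contradiction refl ne
      differs {true} {false} _ = refl
      differs {false} {true} _ = refl
      differs {false} {false} ne = contradiction refl ne

  module _ {k} (C : Cyclic k) (B : Shape) (good : Sturdy B) where
    open Cyclic C
    open Shape B
    open Sturdy good
    open Cuts B good
    open Necklace C B good

    -- A discrete intermediate value argument: going round from `a` to `b`, the colour `x` has to be
    -- left somewhere. Exchanging the roles of `a` and `b` gives the change in the other direction.
    descent : (c : Fin k → Bool) → ∀ {x y} a b → c a ≡ x → c b ≡ y → x ≢ y → ∃ λ i → c i ≡ x × c (next i) ≢ x
    descent c {x} a b ca cb x≢y with FP.any? (λ i → (c i Data.Bool.≟ x) ×-dec ¬? (c (next i) Data.Bool.≟ x))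
    ... | yes found = found
    ... | no none = contradiction (trans (sym all-x) cb) x≢y
      where
      advance : ∀ j → c j ≡ x → c (next j) ≡ x
      advance j cj with c (next j) Data.Bool.≟ x
      ... | yes e = e
      ... | no ne = contradiction (j , cj , ne) none
      all-x : c b ≡ x
      -- Cutting the ring at `prev a` makes `a` the base case.
      all-x = induction (λ j → c j ≡ x) (prev a) (trans (cong c (next-prev a)) ca) (λ j _ → advance j) b

    module _ (S : V → Bool) where

      side : Fin k → Vertex → Bool
      side i a = S ⟨ i , a ⟩

      -- A link is charged to the block that contains its `right` end, so that each cut edge is
      -- charged once.
      weight : Fin k → ℕ
      weight i = innerCut (side i) + linkCut (side i) (side (next i))

      -- After doubling, `handshake` gives ordered pairs. These see an inner edge twice within its
      -- block and a link once from either end; `sum-permute` along `prev` moves the second view of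
      -- a link to the block to which it is charged.
      cut-weights : cutSize necklace S ≡ sumF weight
      cut-weights = *-cancelˡ-≡ _ _ 2 (begin
        2 * cutSize necklace S
          ≡⟨ cong (2 *_) (sum-cong λ x → trans (count≡sum (λ y → adj necklace x y ∧ (⌊ x <? y ⌋ ∧ (S x xor S y)))) (trans (sum-cong λ y → cong ind (rearrange (adj necklace x y) ⌊ x <? y ⌋ (S x xor S y))) (sym (count≡sum (λ y → crossing x y ∧ ⌊ x <? y ⌋))))) ⟩
        2 * sumF (λ x → count (λ y → crossing x y ∧ ⌊ x <? y ⌋))
          ≡⟨ sym (handshake crossing crossing-sym crossing-irrefl) ⟩
        sumF (λ x → count (crossing x))
          ≡⟨ sum-places _ ⟩
        sumF (λ i → sumF (λ a → count (crossing ⟨ i , a ⟩)))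
          ≡⟨ sum-cong (λ i → trans (sum-cong {size} λ a → trans (count≡sum (crossing ⟨ i , a ⟩)) (sum-neighbours i a (λ y → S ⟨ i , a ⟩ xor S y)))
               (trans (sum-+ {size} _ _) (cong₂ _+_ (sum-inner (side i)) (trans (sum-+ {size} _ _)
                 (cong₂ _+_ (sum-link (side i) (side (next i))) (sum-link-back (side i) (side (prev i)))))))) ⟩
        sumF (λ i → (innerCut (side i) + innerCut (side i)) + (L i + linkCut (side (prev i)) (side i)))
          ≡⟨ sum-cong (λ i → cong (λ z → (innerCut (side i) + innerCut (side i)) + (L i + linkCut (side (prev i)) (side z))) (sym (next-prev i))) ⟩
        sumF (λ i → (innerCut (side i) + innerCut (side i)) + (L i + L (prev i)))
          ≡⟨ trans (sum-+ {k} _ _) (cong₂ _+_ (sum-+ {k} _ _) (trans (sum-+ {k} L (λ i → L (prev i))) (cong (sumF L +_) (sum-permute prev next prev-next next-prev L)))) ⟩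
        (I + I) + (sumF L + sumF L)
          ≡⟨ interchange I I (sumF L) (sumF L) ⟩
        (I + sumF L) + (I + sumF L)
          ≡⟨ cong (λ z → z + z) (sym (sum-+ {k} _ L)) ⟩
        sumF weight + sumF weight
          ≡⟨ cong (sumF weight +_) (sym (+-identityʳ _)) ⟩
        2 * sumF weight ∎)
        where
        open ≡-Reasoning
        open import Algebra.Properties.CommutativeSemigroup +-commutativeSemigroup using (interchange)
        L : Fin k → ℕ
        L i = linkCut (side i) (side (next i))
        I : ℕ
        I = sumF (λ i → innerCut (side i))
        crossing : V → V → Bool
        crossing x y = adj necklace x y ∧ (S x xor S y)
        crossing-sym : ∀ x y → crossing x y ≡ crossing y x
        crossing-sym x y = cong₂ _∧_ (Graph.sym necklace x y) (xor-comm (S x) (S y))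
        crossing-irrefl : ∀ x → crossing x x ≡ false
        crossing-irrefl x = cong (_∧ (S x xor S x)) (irrefl necklace x)
        rearrange : ∀ x y z → x ∧ (y ∧ z) ≡ (x ∧ z) ∧ y
        rearrange x y z = trans (cong (x ∧_) (∧-comm y z)) (sym (∧-assoc x z y))

      module _ (small : sumF weight < 6) where

        one-heavy : ∀ {i j} → i ≢ j → 3 ≤ weight i → 3 ≤ weight j → ⊥
        one-heavy i≢j wi wj = <⇒≱ small (≤-trans (+-mono-≤ wi wj) (sum-≥₂ weight i≢j))

        Constant : Fin k → Bool → Set
        Constant i c = ∀ a → side i a ≡ c

        step-heavy : ∀ {i c d} → Constant i c → Constant (next i) d → c ≢ d → 3 ≤ weight i
        step-heavy {i} ci di c≢d = ≤-trans (linkCut-constant ci di c≢d) (m≤n+m _ (innerCut (side i)))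

        -- Going round the ring, the side changes from true to false and also back. These are two
        -- different boundaries between blocks, and each costs three links.
        not-all-constant : (∀ i → ∃ (Constant i)) → ∀ {p q} → S p ≡ true → S q ≡ false → ⊥
        not-all-constant const {p} {q} Sp Sq
          with descent c (block p) (block q) (c-at p Sp) (c-at q Sq) (λ ()) | descent c (block q) (block p) (c-at q Sq) (c-at p Sp) (λ ())
          where
          c : Fin k → Bool
          c i = proj₁ (const i)
          block : V → Fin k
          block x = proj₁ (loc x)
          c-at : ∀ x {s} → S x ≡ s → c (block x) ≡ s
          c-at x Sx = trans (sym (proj₂ (const (block x)) (proj₂ (loc x)))) (trans (cong S (⟨⟩-loc x)) Sx)
        ... | i , ci , ci′ | j , cj , cj′ = one-heavy i≢j (heavy ci ci′) (heavy cj cj′)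
          where
          heavy : ∀ {i x} → proj₁ (const i) ≡ x → proj₁ (const (next i)) ≢ x → 3 ≤ weight i
          heavy {i} e ne = step-heavy (proj₂ (const i)) (proj₂ (const (next i))) λ e′ → ne (trans (sym e′) e)
          i≢j : i ≢ j
          i≢j refl with () ← trans (sym ci) cj

        module _ {i} (heavy : 3 ≤ innerCut (side i)) where

          private
            heavy-i : 3 ≤ weight i
            heavy-i = ≤-trans heavy (m≤m+n _ _)

            constant : ∀ j → j ≢ i → ∃ (Constant j)
            constant j j≢i with innerCut-nonconstant (side j)
            ... | inj₁ big = ⊥-elim (one-heavy j≢i (≤-trans big (m≤m+n _ _)) heavy-i)
            ... | inj₂ c = c

            w : Bool
            w = proj₁ (constant (next i) (next≢ i))

            -- The induction runs from `next i` around to the block before `i`. A change of side on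
            -- the way would make a second block heavy.
            outside : ∀ j → j ≢ i → Constant j w
            outside = induction (λ j → j ≢ i → Constant j w) i (λ _ → proj₂ (constant (next i) (next≢ i))) advance
              where
              advance : ∀ j → j ≢ i → (j ≢ i → Constant j w) → next j ≢ i → Constant (next j) w
              advance j j≢i ih nj≢i with constant (next j) nj≢i
              ... | d , at-d with w Data.Bool.≟ d
              ...   | yes refl = at-d
              ...   | no w≢d = ⊥-elim (one-heavy j≢i (step-heavy (ih j≢i) at-d w≢d) heavy-i)

            prev≢ : prev i ≢ i
            prev≢ e = next≢ i (trans (cong next (sym e)) (next-prev i))

            right-cut : linkCut (side i) (side (next i)) ≡ sumF (λ e → ind (side i (right e) xor w))
            right-cut = sum-cong {3} λ e → cong (λ z → ind (side i (right e) xor z)) (outside (next i) (next≢ i) (left e))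

            left-cut : linkCut (side (prev i)) (side (next (prev i))) ≡ sumF (λ e → ind (side i (left e) xor w))
            left-cut = sum-cong {3} λ e → cong ind (trans (xor-comm (side (prev i) (right e)) (side (next (prev i)) (left e)))
              (cong₂ _xor_ (cong (λ z → side z (left e)) (next-prev i)) (outside (prev i) prev≢ (right e))))

            -- The links at the left attachments of block `i` are charged to `prev i`, so two
            -- weights together bound the contracted cut.
            contracted-small : innerCut (side i) + outerCut (side i) w < 6
            contracted-small = ≤-<-trans (begin
              innerCut (side i) + outerCut (side i) w ≡⟨ +-assoc (innerCut (side i)) _ _ ⟨
              (innerCut (side i) + _) + _ ≡⟨ cong₂ (λ x y → (innerCut (side i) + x) + y) (sym right-cut) (sym left-cut) ⟩
              weight i + linkCut (side (prev i)) (side (next (prev i))) ≤⟨ +-monoʳ-≤ (weight i) (m≤n+m _ (innerCut (side (prev i)))) ⟩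
              weight i + weight (prev i) ≤⟨ sum-≥₂ weight (λ e → prev≢ (sym e)) ⟩
              sumF weight ∎) small
              where open ≤-Reasoning

          -- An edge without an end in block `i` has both ends on side `w` and is not cut. The
          -- remaining edges are those of the contracted graph, for which `contracted-cut` supplies
          -- the centre.
          star : ∃ λ v → ∀ {p q} → Adjacent p q → uncurry side p xor uncurry side q ≡ true → p ≡ (i , v) ⊎ q ≡ (i , v)
          star with contracted-cut (side i) w
          ... | inj₁ big = contradiction big (<⇒≱ contracted-small)
          ... | inj₂ (v , st) = v , at
            where
            open Star st
            same : ∀ {x y} → x ≡ w → y ≡ w → x xor y ≡ true → ∀ {A : Set} → A
            same refl refl e with () ← trans (sym e) (xor-same w)
            along : ∀ j e → side j (right e) xor side (next j) (left e) ≡ true →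
                    (j , right e) ≡ (i , v) ⊎ (next j , left e) ≡ (i , v)
            along j e x with j F.≟ i
            ... | yes refl = inj₁ (cong (i ,_) (star-right e (trans (cong (side i (right e) xor_) (sym (outside (next i) (next≢ i) (left e)))) x)))
            ... | no j≢i with next j F.≟ i
            ...   | no nj≢i = same (outside j j≢i (right e)) (outside (next j) nj≢i (left e)) x
            ...   | yes refl = inj₂ (cong (i ,_) (star-left e (trans (cong (side i (left e) xor_) (sym (outside j j≢i (right e)))) (trans (xor-comm (side i (left e)) _) x))))
            at : ∀ {p q} → Adjacent p q → uncurry side p xor uncurry side q ≡ true → p ≡ (i , v) ⊎ q ≡ (i , v)
            at (forth j e) x = along j e x
            at (back j e) x = Sum.swap (along j e (trans (xor-comm (side j (right e)) _) x))
            at (inside {j} {a} {b} ab) x with j F.≟ i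
            ... | no j≢i = same (outside j j≢i a) (outside j j≢i b) x
            ... | yes refl with inner-edge {a} {b} ab
            ...   | inj₁ ab∈ = Sum.map (cong (i ,_)) (cong (i ,_)) (star-inner ab∈ x)
            ...   | inj₂ ba∈ = Sum.swap (Sum.map (cong (i ,_)) (cong (i ,_)) (star-inner ba∈ (trans (xor-comm (side i b) _) x)))

    ess-edge-connected : EssEdgeConnected 6 necklace
    ess-edge-connected S (p , Sp) (q , Sq) small with FP.any? (λ i → 3 ≤? innerCut (side S i))
    ... | no none = ⊥-elim (not-all-constant S small′ const Sp Sq)
      where
      small′ = subst (_< 6) (cut-weights S) small
      const : ∀ i → ∃ (Constant S small′ i)
      const i with innerCut-nonconstant (side S i)
      ... | inj₁ big = contradiction (i , big) none
      ... | inj₂ c = c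
    ... | yes (i , heavy) with star S (subst (_< 6) (cut-weights S) small) heavy
    ...   | v , at = ⟨ i , v ⟩ , λ x y xy Sxy → Sum.map (back-to x) (back-to y)
              (at (adjacent⇒ {loc x} {loc y} xy) (trans (cong₂ (λ x y → S x xor S y) (⟨⟩-loc x) (⟨⟩-loc y)) Sxy))
      where
      back-to : ∀ x → loc x ≡ (i , v) → x ≡ ⟨ i , v ⟩
      back-to x e = trans (sym (⟨⟩-loc x)) (cong (uncurry ⟨_,_⟩) e)

-- 4-connectivity of the ring.

module VertexCuts where

  open import Defs hiding (sym)
  open Sums
  open Blocks
  open Necklaces
  open import Data.Bool using (Bool; true; false; if_then_else_; _∨_)
  open import Data.Fin using (Fin; _↑ˡ_; _↑ʳ_; splitAt)
  open import Data.Fin.Patterns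
  import Data.Fin as F
  import Data.Fin.Properties as FP
  open import Data.List using ([]; _∷_)
  open import Data.List.Relation.Unary.All using ([]; _∷_)
  open import Data.List.Relation.Unary.AllPairs using ([]; _∷_)
  open import Data.Nat hiding (_<?_)
  open import Data.Nat.Properties hiding (_<?_; _≟_)
  open import Data.Product using (Σ; _×_; _,_; ∃; proj₁; proj₂; uncurry)
  open import Data.Sum using (inj₁; inj₂; [_,_]′)
  open import Relation.Nullary using (yes; no; contradiction)
  open import Relation.Binary.PropositionalEquality

  module _ {G : Graph} {X : Fin (n G) → Bool} where

    Avoiding : Fin (n G) → Fin (n G) → Set
    Avoiding = Walk G (λ x → if X x then false else true)

    kept : ∀ {v} → X v ≡ false → (if X v then false else true) ≡ true
    kept e rewrite e = refl

    step-kept : ∀ {u v} → adj G u v ≡ true → X v ≡ false → Avoiding u v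
    step-kept uv v∉ = step uv (kept v∉) here

    walk-trans : ∀ {u v w} → Avoiding u v → Avoiding v w → Avoiding u w
    walk-trans here q = q
    walk-trans (step uv v∉ p) q = step uv v∉ (walk-trans p q)

    -- `Walk` tests only the vertices it enters, so the start of a walk must be known to be kept
    -- before the walk can be reversed.
    walk-sym : ∀ {u v} → X u ≡ false → Avoiding u v → Avoiding v u
    walk-sym _ here = here
    walk-sym {u} u∉ (step {v = v} uv ok p) = walk-trans (walk-sym v∉ p) (step-kept (trans (Graph.sym G v u) uv) u∉)
      where
      v∉ : X v ≡ false
      v∉ with X v
      ... | false = refl

  module _ {k} (C : Cyclic k) (B : Shape) (good : Sturdy B) where
    open Cyclic C
    open Shape B
    open Sturdy good
    open Necklace C B good

    module _ (X : V → Bool) (few : count X < 4) where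

      _⇝_ : V → V → Set
      _⇝_ = Avoiding {necklace} {X}

      deleted : Fin k → Vertex → Bool
      deleted i a = X ⟨ i , a ⟩

      losses : Fin k → ℕ
      losses i = count (deleted i)

      few-losses : sumF losses < 4
      few-losses = subst (_< 4) (trans (count≡sum X) (trans (sum-places _) (sum-cong λ i → sym (count≡sum (deleted i))))) few

      Kept : Fin k → Set
      Kept i = ∃ λ a → deleted i a ≡ false

      at : ∀ {i} → Kept i → V
      at {i} (a , _) = ⟨ i , a ⟩

      across : ∀ {p q} → Adjacent p q → X (uncurry ⟨_,_⟩ q) ≡ false → uncurry ⟨_,_⟩ p ⇝ uncurry ⟨_,_⟩ q
      across {i , a} {j , b} pq = step-kept (trans (adj-⟨⟩ i a j b) (⇒adjacent pq))

      reach⇒walk : ∀ i {S a} → Reach (deleted i) S a → deleted i a ≡ false → ∃ λ b → S b × deleted i b ≡ false × (⟨ i , a ⟩ ⇝ ⟨ i , b ⟩)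
      reach⇒walk i (stop s) a∉ = _ , s , a∉ , here
      reach⇒walk i (move ab b∉ r) _ with reach⇒walk i r b∉
      ... | c , s , c∉ , walk = c , s , c∉ , walk-trans (across (inside ab) b∉) walk

      kept-vertex : ∀ {i} → losses i < 2 → Kept i
      kept-vertex {i} light with block-connected (deleted i)
      ... | inj₁ heavy = contradiction heavy (<⇒≱ light)
      ... | inj₂ (r , r∉ , _) = r , r∉

      within : ∀ {i} → losses i < 2 → (u v : Kept i) → at u ⇝ at v
      within {i} light (a , a∉) (b , b∉) with block-connected (deleted i)
      ... | inj₁ heavy = contradiction heavy (<⇒≱ light)
      ... | inj₂ (r , r∉ , to-r) with reach⇒walk i (to-r a a∉) a∉ | reach⇒walk i (to-r b b∉) b∉
      ...   | _ , refl , _ , p | _ , refl , _ , q = walk-trans p (walk-sym b∉ q)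

      record Bridge (i : Fin k) : Set where
        field
          strand : Fin 3
          right∉ : deleted i (right strand) ≡ false
          left∉ : deleted (next i) (left strand) ≡ false

      right-losses : ∀ i → sumF (λ e → ind (deleted i (right e))) ≤ losses i
      right-losses i = ≤-trans (sum-≥-unique (λ a → ind (deleted i a)) right!) (≤-reflexive (sym (count≡sum (deleted i))))

      left-losses : ∀ i → sumF (λ e → ind (deleted i (left e))) ≤ losses i
      left-losses i = ≤-trans (sum-≥-unique (λ a → ind (deleted i a)) left!) (≤-reflexive (sym (count≡sum (deleted i))))

      -- The three links have distinct ends on either side, so blocking all of them takes three
      -- deletions in the two blocks.
      bridge : ∀ i → losses i + losses (next i) < 3 → Bridge i
      bridge i light with FP.any? (λ e → (deleted i (right e) ∨ deleted (next i) (left e)) Data.Bool.≟ false)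
      ... | yes (e , e∉) = record { strand = e ; right∉ = proj₁ (split e∉) ; left∉ = proj₂ (split e∉) }
        where
        split : ∀ {x y} → x ∨ y ≡ false → x ≡ false × y ≡ false
        split {false} {false} _ = refl , refl
      ... | no none = contradiction light (≤⇒≯ (begin
          3 ≤⟨ sum-mono {3} blocked ⟩
          sumF (λ e → ind (deleted i (right e)) + ind (deleted (next i) (left e))) ≡⟨ sum-+ {3} (λ e → ind (deleted i (right e))) (λ e → ind (deleted (next i) (left e))) ⟩
          sumF (λ e → ind (deleted i (right e))) + sumF (λ e → ind (deleted (next i) (left e)))
            ≤⟨ +-mono-≤ (right-losses i) (left-losses (next i)) ⟩
          losses i + losses (next i) ∎))
        where
        open ≤-Reasoning
        blocked : ∀ e → 1 ≤ ind (deleted i (right e)) + ind (deleted (next i) (left e))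
        blocked e with deleted i (right e) | deleted (next i) (left e) | (λ p → none (e , p))
        ... | true | _ | _ = s≤s z≤n
        ... | false | true | _ = s≤s z≤n
        ... | false | false | open! = contradiction refl open!

      -- The ring is opened at `i`. Starting in `next i`, surviving links lead through all the other
      -- blocks, which stay connected; the vertices of `i` itself are attached afterwards through
      -- `leave`.
      module _ (i : Fin k) (light : ∀ j → j ≢ i → losses j < 2)
               (bridges : ∀ j → j ≢ i → next j ≢ i → Bridge j)
               (leave : ∀ (u : Kept i) → ∃ λ j → j ≢ i × Σ (Kept j) λ v → at u ⇝ at v) where

        base : Kept (next i)
        base = kept-vertex (light (next i) (next≢ i))

        from-base : ∀ j → j ≢ i → (u : Kept j) → at base ⇝ at u
        from-base = induction (λ j → j ≢ i → (u : Kept j) → at base ⇝ at u) i (λ _ → within (light (next i) (next≢ i)) base) advance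
          where
          advance : ∀ j → j ≢ i → (j ≢ i → (u : Kept j) → at base ⇝ at u) → next j ≢ i → (u : Kept (next j)) → at base ⇝ at u
          advance j j≢i ih nj≢i u = walk-trans (ih j≢i (_ , right∉)) (walk-trans (across (forth j strand) left∉)
              (within (light (next j) nj≢i) (_ , left∉) u))
            where open Bridge (bridges j j≢i nj≢i)

        from-base′ : ∀ j (u : Kept j) → at base ⇝ at u
        from-base′ j u with j F.≟ i
        ... | no j≢i = from-base j j≢i u
        ... | yes refl with leave u
        ...   | l , l≢i , v , walk = walk-trans (from-base l l≢i v) (walk-sym (proj₂ u) walk)

        joined : ConnectedWithout necklace X
        joined x y x∉ y∉ = subst₂ _⇝_ (⟨⟩-loc x) (⟨⟩-loc y)
          (walk-trans (walk-sym (proj₂ base) (from-base′ _ (place x x∉))) (from-base′ _ (place y y∉)))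
          where
          place : ∀ x → X x ≡ false → Kept (proj₁ (loc x))
          place x x∉ = proj₂ (loc x) , trans (cong X (⟨⟩-loc x)) x∉

      prev≢ : ∀ i → prev i ≢ i
      prev≢ i e = next≢ i (trans (cong next (sym e)) (next-prev i))

      next≢prev : ∀ i → next i ≢ prev i
      next≢prev i e = next²≢ i (trans (cong next e) (next-prev i))

      module _ (i : Fin k) where

        neighbour : Fin 6 → Bool
        neighbour 0F = deleted (next i) (left 0F)
        neighbour 1F = deleted (next i) (left 1F)
        neighbour 2F = deleted (next i) (left 2F)
        neighbour 3F = deleted (prev i) (right 0F)
        neighbour 4F = deleted (prev i) (right 1F)
        neighbour 5F = deleted (prev i) (right 2F)

        around : Fin (size + 6) → Bool
        around x = [ deleted i , neighbour ]′ (splitAt size x)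

        around-block : ∀ a → around (a ↑ˡ 6) ≡ deleted i a
        around-block a = cong [ deleted i , neighbour ]′ (FP.splitAt-↑ˡ size a 6)

        around-neighbour : ∀ e → around (size ↑ʳ e) ≡ neighbour e
        around-neighbour e = cong [ deleted i , neighbour ]′ (FP.splitAt-↑ʳ size 6 e)

        -- The outer neighbours of the attachments are distinct vertices of `next i` and `prev i`,
        -- and these blocks differ from each other and from `i`. The deletions seen around the block
        -- are therefore distinct deletions of `X`.
        few-around : count around < 4
        few-around = ≤-<-trans (begin
          count around ≡⟨ trans (count≡sum around) (sum-++ size {6} (λ x → ind (around x))) ⟩
          sumF (λ a → ind (around (a ↑ˡ 6))) + sumF {6} (λ e → ind (around (size ↑ʳ e)))
            ≡⟨ cong₂ _+_ (trans (sum-cong λ a → cong ind (around-block a)) (sym (count≡sum (deleted i))))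
                         (trans (sum-cong {6} λ e → cong ind (around-neighbour e)) (sum-++ 3 {3} (λ e → ind (neighbour e)))) ⟩
          losses i + (sumF (λ e → ind (deleted (next i) (left e))) + sumF (λ e → ind (deleted (prev i) (right e))))
            ≤⟨ +-monoʳ-≤ (losses i) (+-mono-≤ (left-losses (next i)) (right-losses (prev i))) ⟩
          losses i + (losses (next i) + losses (prev i))
            ≡⟨ cong (λ z → losses i + (losses (next i) + z)) (sym (+-identityʳ _)) ⟩
          sumL losses (i ∷ next i ∷ prev i ∷ [])
            ≤⟨ sum-≥-unique losses (((λ e → next≢ i (sym e)) ∷ (λ e → prev≢ i (sym e)) ∷ []) ∷ (next≢prev i ∷ []) ∷ [] ∷ []) ⟩
          sumF losses ∎) few-losses
          where open ≤-Reasoning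

        through : ∀ e → deleted i (exit e) ≡ false → neighbour e ≡ false → ∃ λ j → j ≢ i × Σ (Kept j) λ v → ⟨ i , exit e ⟩ ⇝ at v
        through 0F _ e∉ = next i , next≢ i , (_ , e∉) , across (forth i 0F) e∉
        through 1F _ e∉ = next i , next≢ i , (_ , e∉) , across (forth i 1F) e∉
        through 2F _ e∉ = next i , next≢ i , (_ , e∉) , across (forth i 2F) e∉
        through 3F _ e∉ = prev i , prev≢ i , (_ , e∉) , across (back-prev i 0F) e∉
        through 4F _ e∉ = prev i , prev≢ i , (_ , e∉) , across (back-prev i 1F) e∉
        through 5F _ e∉ = prev i , prev≢ i , (_ , e∉) , across (back-prev i 2F) e∉

        leave : (u : Kept i) → ∃ λ j → j ≢ i × Σ (Kept j) λ v → at u ⇝ at v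
        leave (a , a∉) with block-escape around
        ... | inj₁ many = contradiction few-around (≤⇒≯ many)
        ... | inj₂ escape with reach⇒walk i (transport (escape a (trans (around-block a) a∉))) a∉
          where
          transport : ∀ {S a} → Reach (λ a → around (a ↑ˡ 6)) S a → Reach (deleted i) S a
          transport (stop s) = stop s
          transport (move ab b∉ r) = move ab (trans (sym (around-block _)) b∉) (transport r)
        ...   | _ , (e , refl , open!) , b∉ , walk with through e b∉ (trans (sym (around-neighbour e)) open!)
        ...     | j , j≢i , v , on = j , j≢i , v , walk-trans walk on

      -- If block `i` loses two vertices, all the others together lose at most one, so they are
      -- light and any two neighbours among them keep a link.
      connected-without : ConnectedWithout necklace X
      connected-without x y x∉ y∉ with FP.any? (λ i → 2 ≤? losses i)
      ... | yes (i , heavy) = joined i light bridges (leave i) x y x∉ y∉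
        where
        light : ∀ j → j ≢ i → losses j < 2
        light j j≢i = +-cancelˡ-< 2 (losses j) 2 (≤-<-trans (+-monoˡ-≤ (losses j) heavy)
          (≤-<-trans (sum-≥₂ losses (λ e → j≢i (sym e))) few-losses))
        bridges : ∀ j → j ≢ i → next j ≢ i → Bridge j
        bridges j j≢i nj≢i = bridge j (m<n⇒m<1+n (+-cancelˡ-< 2 _ 2 (≤-<-trans (+-monoˡ-≤ _ heavy) (≤-<-trans
          (subst (λ z → losses i + (losses j + z) ≤ sumF losses) (+-identityʳ _)
            (sum-≥-unique losses (((λ e → j≢i (sym e)) ∷ (λ e → nj≢i (sym e)) ∷ []) ∷ ((λ e → next≢ j (sym e)) ∷ []) ∷ [] ∷ []))) few-losses))))
      -- Two neighbouring blocks now lose at most one vertex each, which is fewer than three in all,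
      -- so the ring may be opened at any block; that of `x` is at hand.
      ... | no none = joined (proj₁ (loc x)) (λ j _ → light j) (λ j _ _ → bridge j (s≤s (+-mono-≤ (s≤s⁻¹ (light j)) (s≤s⁻¹ (light (next j)))))) (leave (proj₁ (loc x))) x y x∉ y∉
        where
        light : ∀ j → losses j < 2
        light j = ≰⇒> λ heavy → none (j , heavy)

    k-connected : 4 < k * size → KConnected 4 necklace
    k-connected big = big , connected-without

-- Segments on opposite sides of a line are disjoint.

module Separation where

  open import Defs hiding (sym)
  open import Data.Integer as ℤ using (ℤ; +_; _+_; _*_; _-_; -_; _≤_; _<_; _⊓_; _⊔_; 0ℤ; 1ℤ)
  import Data.Integer.Properties as ℤ
  open import Data.Integer.Tactic.RingSolver using (solve-∀)
  open import Data.Empty using (⊥)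
  open import Data.Product using (_×_; _,_; proj₁; proj₂)
  open import Data.Sum using (_⊎_; inj₁; inj₂)
  open import Relation.Nullary using (¬_; yes; no; contradiction)
  open import Relation.Binary.PropositionalEquality
  open import Relation.Binary.Definitions using (tri<; tri≈; tri>)

  0≤* : ∀ {x y} → 0ℤ ≤ x → 0ℤ ≤ y → 0ℤ ≤ x * y
  0≤* {x} {y} 0≤x 0≤y = subst (_≤ x * y) (ℤ.*-zeroʳ x) (ℤ.*-monoˡ-≤-nonNeg x {{ℤ.nonNegative 0≤x}} 0≤y)

  0<* : ∀ {x y} → 0ℤ < x → 0ℤ < y → 0ℤ < x * y
  0<* {x} {y} 0<x 0<y = subst (_< x * y) (ℤ.*-zeroʳ x) (ℤ.*-monoˡ-<-pos x {{ℤ.positive 0<x}} 0<y)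

  lin : ℤ → ℤ → ℤ → Point → ℤ
  lin α β γ (x , y) = α * x + β * y + γ

  square-pos : ∀ {x} → x ≢ 0ℤ → 0ℤ < x * x
  square-pos {x} x≢0 with ℤ.<-cmp x 0ℤ
  ... | tri< x<0 _ _ = subst (0ℤ <_) (neg² x) (0<* (ℤ.neg-mono-< x<0) (ℤ.neg-mono-< x<0))
    where
    neg² : ∀ x → (- x) * (- x) ≡ x * x
    neg² = solve-∀
  ... | tri≈ _ x≡0 _ = contradiction x≡0 x≢0
  ... | tri> _ _ 0<x = 0<* 0<x 0<x

  -- If `x` has parameter t on the interval from `a` to `b`, the two quantities are t and 1 - t
  -- scaled by the square of `b - a`, which avoids division.
  between : ∀ {a b x} → a ⊓ b ≤ x → x ≤ a ⊔ b →
            0ℤ ≤ (b - a) * (x - a) × 0ℤ ≤ (b - a) * (b - a) - (b - a) * (x - a)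
  between {a} {b} {x} lo hi with ℤ.≤-total a b
  ... | inj₁ a≤b = 0≤* 0≤b-a (ℤ.i≤j⇒0≤j-i a≤x) , subst (0ℤ ≤_) (rest a b x) (0≤* 0≤b-a (ℤ.i≤j⇒0≤j-i x≤b))
    where
    0≤b-a = ℤ.i≤j⇒0≤j-i a≤b
    a≤x = subst (_≤ x) (ℤ.i≤j⇒i⊓j≡i a≤b) lo
    x≤b = subst (x ≤_) (ℤ.i≤j⇒i⊔j≡j a≤b) hi
    rest : ∀ a b x → (b - a) * (b - x) ≡ (b - a) * (b - a) - (b - a) * (x - a)
    rest = solve-∀
  ... | inj₂ b≤a = subst (0ℤ ≤_) (flip a b x) (0≤* 0≤a-b (ℤ.i≤j⇒0≤j-i x≤a)) , subst (0ℤ ≤_) (rest a b x) (0≤* 0≤a-b (ℤ.i≤j⇒0≤j-i b≤x))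
    where
    0≤a-b = ℤ.i≤j⇒0≤j-i b≤a
    b≤x = subst (_≤ x) (ℤ.i≥j⇒i⊓j≡j b≤a) lo
    x≤a = subst (x ≤_) (ℤ.i≥j⇒i⊔j≡i b≤a) hi
    flip : ∀ a b x → (a - b) * (a - x) ≡ (b - a) * (x - a)
    flip = solve-∀
    rest : ∀ a b x → (a - b) * (x - b) ≡ (b - a) * (b - a) - (b - a) * (x - a)
    rest = solve-∀

  between-degenerate : ∀ {a b x} → a ⊓ b ≤ x → x ≤ a ⊔ b → b - a ≡ 0ℤ → x ≡ a
  between-degenerate {a} {b} {x} lo hi e with refl ← ℤ.i-j≡0⇒i≡j b a e =
    ℤ.≤-antisym (subst (x ≤_) (ℤ.⊔-idem a) hi) (subst (_≤ x) (ℤ.⊓-idem a) lo)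

  square-nonneg : ∀ x → 0ℤ ≤ x * x
  square-nonneg x with x ℤ.≟ 0ℤ
  ... | yes refl = ℤ.≤-refl
  ... | no x≢0 = ℤ.<⇒≤ (square-pos x≢0)

  -- Scaled by the squared length of the segment, the value at `r` is a nonnegative combination of
  -- the values at `p` and `q` plus a multiple of `orient p q r`, which vanishes. For a segment of
  -- length zero the scaling says nothing, and the bounding box forces `r` to be `p`.
  halfplane-convex : ∀ α β γ p q r → OnSeg p q r → 0ℤ ≤ lin α β γ p → 0ℤ ≤ lin α β γ q → 0ℤ ≤ lin α β γ r
  halfplane-convex α β γ p@(px , py) q@(qx , qy) r@(rx , ry) (line , xlo , xhi , ylo , yhi) 0≤Lp 0≤Lq = by-cases
    where
    dx = qx - px
    dy = qy - py
    identity : ∀ α β γ px py qx qy rx ry →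
      ((qx - px) * (qx - px) + (qy - py) * (qy - py)) * (α * rx + β * ry + γ) ≡
      ((((qx - px) * (qx - px) - (qx - px) * (rx - px)) + ((qy - py) * (qy - py) - (qy - py) * (ry - py))) * (α * px + β * py + γ)
      + ((qx - px) * (rx - px) + (qy - py) * (ry - py)) * (α * qx + β * qy + γ))
      + ((qx - px) * (ry - py) - (qy - py) * (rx - px)) * (β * (qx - px) - α * (qy - py))
    identity = solve-∀
    0≤scaled : 0ℤ ≤ (dx * dx + dy * dy) * lin α β γ r
    0≤scaled = subst (0ℤ ≤_) (sym (identity α β γ px py qx qy rx ry))
      (ℤ.+-mono-≤ (ℤ.+-mono-≤ (0≤* (ℤ.+-mono-≤ (proj₂ bx) (proj₂ by)) 0≤Lp) (0≤* (ℤ.+-mono-≤ (proj₁ bx) (proj₁ by)) 0≤Lq))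
        (ℤ.≤-reflexive (sym (cong (_* (β * dx - α * dy)) line))))
      where
      bx = between {px} {qx} {rx} xlo xhi
      by = between {py} {qy} {ry} ylo yhi
    cancel : 0ℤ < dx * dx + dy * dy → 0ℤ ≤ lin α β γ r
    cancel 0<dd = ℤ.*-cancelˡ-≤-pos 0ℤ (lin α β γ r) (dx * dx + dy * dy) {{ℤ.positive 0<dd}}
      (subst (_≤ (dx * dx + dy * dy) * lin α β γ r) (sym (ℤ.*-zeroʳ (dx * dx + dy * dy))) 0≤scaled)
    by-cases : 0ℤ ≤ lin α β γ r
    by-cases with dx ℤ.≟ 0ℤ | dy ℤ.≟ 0ℤ
    ... | no dx≢0 | _ = cancel (ℤ.+-mono-<-≤ (square-pos dx≢0) (square-nonneg dy))
    ... | yes _ | no dy≢0 = cancel (ℤ.+-mono-≤-< (square-nonneg dx) (square-pos dy≢0))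
    ... | yes dx≡0 | yes dy≡0 = subst (λ z → 0ℤ ≤ lin α β γ z)
      (sym (cong₂ _,_ (between-degenerate {px} {qx} xlo xhi dx≡0) (between-degenerate {py} {qy} ylo yhi dy≡0))) 0≤Lp

  -- A certificate of disjointness in three integers: at a common point the affine form would be
  -- both nonnegative and negative. It can be tested by evaluation and transported along
  -- translations.
  record Separated (p q r s : Point) : Set where
    constructor separated
    field
      α β γ : ℤ
      p≥ : 0ℤ ≤ lin α β γ p
      q≥ : 0ℤ ≤ lin α β γ q
      r< : lin α β γ r < 0ℤ
      s< : lin α β γ s < 0ℤ

  -- −1 − L is nonnegative exactly where the integer-valued L is negative.
  lin-complement : ∀ α β γ p → lin (- α) (- β) (- γ - 1ℤ) p ≡ - (1ℤ + lin α β γ p)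
  lin-complement α β γ (x , y) = identity α β γ x y
    where
    identity : ∀ α β γ x y → (- α) * x + (- β) * y + (- γ - 1ℤ) ≡ - (1ℤ + (α * x + β * y + γ))
    identity = solve-∀

  complement-≥ : ∀ α β γ p → lin α β γ p < 0ℤ → 0ℤ ≤ lin (- α) (- β) (- γ - 1ℤ) p
  complement-≥ α β γ p L<0 = subst (0ℤ ≤_) (sym (lin-complement α β γ p)) (ℤ.neg-mono-≤ {1ℤ + lin α β γ p} {0ℤ} (ℤ.i<j⇒suc[i]≤j L<0))

  complement-< : ∀ α β γ p → 0ℤ ≤ lin α β γ p → lin (- α) (- β) (- γ - 1ℤ) p < 0ℤ
  complement-< α β γ p 0≤L = subst (_< 0ℤ) (sym (lin-complement α β γ p)) (ℤ.neg-mono-< {0ℤ} {1ℤ + lin α β γ p} (ℤ.suc[i]≤j⇒i<j (ℤ.+-monoʳ-≤ 1ℤ 0≤L)))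

  flip-sides : ∀ {p q r s} → Separated p q r s → Separated r s p q
  flip-sides {p} {q} {r} {s} (separated α β γ p≥ q≥ r< s<) = separated (- α) (- β) (- γ - 1ℤ)
    (complement-≥ α β γ r r<) (complement-≥ α β γ s s<) (complement-< α β γ p p≥) (complement-< α β γ q q≥)

  flip-first : ∀ {p q r s} → Separated p q r s → Separated q p r s
  flip-first (separated α β γ p≥ q≥ r< s<) = separated α β γ q≥ p≥ r< s<

  flip-second : ∀ {p q r s} → Separated p q r s → Separated p q s r
  flip-second (separated α β γ p≥ q≥ r< s<) = separated α β γ p≥ q≥ s< r<

  ¬OnSeg₁ : ∀ {p q r s} → Separated p q r s → ¬ OnSeg p q r
  ¬OnSeg₁ {p} {q} {r} (separated α β γ p≥ q≥ r< _) on = ℤ.<⇒≱ r< (halfplane-convex α β γ p q r on p≥ q≥)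

  signs : ∀ {x y} → x * y < 0ℤ → (0ℤ < x × y < 0ℤ) ⊎ (x < 0ℤ × 0ℤ < y)
  signs {x} {y} xy<0 with ℤ.<-cmp x 0ℤ | ℤ.<-cmp y 0ℤ
  ... | tri> _ _ 0<x | tri< y<0 _ _ = inj₁ (0<x , y<0)
  ... | tri< x<0 _ _ | tri> _ _ 0<y = inj₂ (x<0 , 0<y)
  ... | tri≈ _ refl _ | _ = contradiction xy<0 (ℤ.<-irrefl (ℤ.*-zeroˡ y))
  ... | _ | tri≈ _ refl _ = contradiction xy<0 (ℤ.<-irrefl (ℤ.*-zeroʳ x))
  ... | tri> _ _ 0<x | tri> _ _ 0<y = contradiction xy<0 (ℤ.<-asym (0<* 0<x 0<y))
  ... | tri< x<0 _ _ | tri< y<0 _ _ = contradiction xy<0 (ℤ.<-asym (subst (0ℤ <_) (neg* x y) (0<* (ℤ.neg-mono-< x<0) (ℤ.neg-mono-< y<0))))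
    where
    neg* : ∀ x y → (- x) * (- y) ≡ x * y
    neg* = solve-∀

  Crossing : Point → Point → Point → Point → Set
  Crossing p q r s = (orient p q r * orient p q s) < 0ℤ × (orient r s p * orient r s q) < 0ℤ

  -- Both sides of the two identities describe the crossing point: as a weighted mean of r, s and as one of p, q.
  ¬Crossing⁺ : ∀ {p q r s} → Separated p q r s → 0ℤ < orient p q r → orient p q s < 0ℤ → ¬ (orient r s p * orient r s q) < 0ℤ
  ¬Crossing⁺ {p@(px , py)} {q@(qx , qy)} {r@(rx , ry)} {s@(sx , sy)} (separated α β γ p≥ q≥ r< s<) 0<A B<0 CD<0 = by-cases (signs {C} {D} CD<0)
    where
    A = orient p q r
    B = orient p q s
    C = orient r s p
    D = orient r s q
    weights : ∀ px py qx qy rx ry sx sy →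
      ((qx - px) * (ry - py) - (qy - py) * (rx - px)) - ((qx - px) * (sy - py) - (qy - py) * (sx - px)) ≡
      ((sx - rx) * (qy - ry) - (sy - ry) * (qx - rx)) - ((sx - rx) * (py - ry) - (sy - ry) * (px - rx))
    weights = solve-∀
    means : ∀ α β γ px py qx qy rx ry sx sy →
      ((qx - px) * (ry - py) - (qy - py) * (rx - px)) * - (α * sx + β * sy + γ)
        + - ((qx - px) * (sy - py) - (qy - py) * (sx - px)) * - (α * rx + β * ry + γ) ≡
      - (((sx - rx) * (qy - ry) - (sy - ry) * (qx - rx)) * (α * px + β * py + γ)
        + - ((sx - rx) * (py - ry) - (sy - ry) * (px - rx)) * (α * qx + β * qy + γ))
    means = solve-∀
    by-cases : (0ℤ < C × D < 0ℤ) ⊎ (C < 0ℤ × 0ℤ < D) → ⊥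
    by-cases (inj₁ (0<C , D<0)) = ℤ.<-asym {0ℤ} {A - B}
      (ℤ.+-mono-< 0<A (ℤ.neg-mono-< B<0))
      (subst (_< 0ℤ) (sym (weights px py qx qy rx ry sx sy)) (ℤ.+-mono-< D<0 (ℤ.neg-mono-< 0<C)))
    by-cases (inj₂ (C<0 , 0<D)) = ℤ.<⇒≱
      (ℤ.+-mono-< (0<* 0<A (ℤ.neg-mono-< s<)) (0<* (ℤ.neg-mono-< B<0) (ℤ.neg-mono-< r<)))
      (subst (_≤ 0ℤ) (sym (means α β γ px py qx qy rx ry sx sy))
        (ℤ.neg-mono-≤ (ℤ.+-mono-≤ (0≤* (ℤ.<⇒≤ 0<D) p≥) (0≤* (ℤ.<⇒≤ (ℤ.neg-mono-< C<0)) q≥))))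

  ¬Crossing : ∀ {p q r s} → Separated p q r s → ¬ Crossing p q r s
  ¬Crossing {p} {q} {r} {s} sep (AB<0 , CD<0) with signs {orient p q r} {orient p q s} AB<0
  ... | inj₁ (0<A , B<0) = ¬Crossing⁺ sep 0<A B<0 CD<0
  ... | inj₂ (A<0 , 0<B) = ¬Crossing⁺ (flip-second sep) 0<B A<0 (subst (_< 0ℤ) (reverse r s p q) CD<0)
    where
    identity : ∀ rx ry sx sy px py qx qy →
      ((sx - rx) * (py - ry) - (sy - ry) * (px - rx)) * ((sx - rx) * (qy - ry) - (sy - ry) * (qx - rx)) ≡
      ((rx - sx) * (py - sy) - (ry - sy) * (px - sx)) * ((rx - sx) * (qy - sy) - (ry - sy) * (qx - sx))
    identity = solve-∀
    reverse : ∀ r s p q → orient r s p * orient r s q ≡ orient s r p * orient s r q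
    reverse (rx , ry) (sx , sy) (px , py) (qx , qy) = identity rx ry sx sy px py qx qy

  separated⇒disjoint : ∀ {p q r s} → Separated p q r s → ¬ SegIntersect p q r s
  separated⇒disjoint sep (inj₁ cross) = ¬Crossing sep cross
  separated⇒disjoint sep (inj₂ (inj₁ on)) = ¬OnSeg₁ sep on
  separated⇒disjoint sep (inj₂ (inj₂ (inj₁ on))) = ¬OnSeg₁ (flip-second sep) on
  separated⇒disjoint sep (inj₂ (inj₂ (inj₂ (inj₁ on)))) = ¬OnSeg₁ (flip-sides sep) on
  separated⇒disjoint sep (inj₂ (inj₂ (inj₂ (inj₂ on)))) = ¬OnSeg₁ (flip-second (flip-sides sep)) on

-- Drawings of a single block and the finite tests that make them fit together.

module Layouts where

  open import Defs hiding (sym)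
  open Sums
  open BooleanChecks
  open Blocks
  open Separation
  open import Data.Bool using (Bool; true; false; T; _∧_; _∨_; not)
  open import Data.Bool.ListAction using (all; any)
  open import Data.Empty using (⊥; ⊥-elim)
  open import Data.Fin using (Fin)
  open import Data.Integer as ℤ using (ℤ; +_; 0ℤ; 1ℤ; -1ℤ)
  import Data.Integer.Properties as ℤ
  open import Data.Integer.Tactic.RingSolver using (solve-∀)
  open import Data.List using (List; []; _∷_)
  open import Data.List.Membership.Propositional using (_∈_)
  open import Data.Nat hiding (_<?_)
  open import Data.Nat.Properties hiding (_<?_; _≟_)
  open import Data.Product using (Σ; _×_; _,_; proj₁; proj₂)
  open import Data.Sum using ([_,_]′)
  open import Relation.Nullary using (yes; Dec)
  open import Relation.Nullary.Decidable using (⌊_⌋)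
  open import Relation.Binary.PropositionalEquality

  ⌊⌋-sound : ∀ {A : Set} {d : Dec A} → ⌊ d ⌋ ≡ true → A
  ⌊⌋-sound {d = yes a} _ = a

  -- Two disjoint segments are separated in a direction normal to one of them, unless they are collinear.
  directions : Point → Point → Point → Point → List (ℤ × ℤ)
  directions p q r s = (1ℤ , 0ℤ) ∷ (-1ℤ , 0ℤ) ∷ (0ℤ , 1ℤ) ∷ (0ℤ , -1ℤ) ∷ normal p q ∷ normal q p ∷ normal r s ∷ normal s r ∷ []
    where
    normal : Point → Point → ℤ × ℤ
    normal (px , py) (qx , qy) = py ℤ.- qy , qx ℤ.- px

  separatesᵇ : Point → Point → Point → Point → ℤ → ℤ → ℤ → Bool
  separatesᵇ p q r s α β γ =
    (⌊ 0ℤ ℤ.≤? lin α β γ p ⌋ ∧ ⌊ 0ℤ ℤ.≤? lin α β γ q ⌋) ∧ (⌊ lin α β γ r ℤ.<? 0ℤ ⌋ ∧ ⌊ lin α β γ s ℤ.<? 0ℤ ⌋)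

  separates-sound : ∀ p q r s α β γ → separatesᵇ p q r s α β γ ≡ true → Separated p q r s
  separates-sound p q r s α β γ e = separated α β γ
    (⌊⌋-sound (proj₁ pq)) (⌊⌋-sound (proj₂ pq)) (⌊⌋-sound (proj₁ rs)) (⌊⌋-sound (proj₂ rs))
    where
    both = ∧-true {⌊ 0ℤ ℤ.≤? lin α β γ p ⌋ ∧ ⌊ 0ℤ ℤ.≤? lin α β γ q ⌋} e
    pq = ∧-true {⌊ 0ℤ ℤ.≤? lin α β γ p ⌋} (proj₁ both)
    rs = ∧-true {⌊ lin α β γ r ℤ.<? 0ℤ ⌋} (proj₂ both)

  -- The least constant term for which the form is nonnegative at `p` and `q`. If it fails to make
  -- `r` and `s` negative, no other constant does in this direction.
  offset : Point → Point → ℤ × ℤ → ℤ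
  offset p q (α , β) = ℤ.- (lin α β 0ℤ p ℤ.⊓ lin α β 0ℤ q)

  -- `admissible` restricts the first coefficient, whose sign decides in which direction an end may
  -- slide horizontally.
  tryᵇ : (ℤ → Bool) → Point → Point → Point → Point → ℤ × ℤ → Bool
  tryᵇ admissible p q r s d = admissible (proj₁ d) ∧ separatesᵇ p q r s (proj₁ d) (proj₂ d) (offset p q d)

  separableᵇ : (ℤ → Bool) → Point → Point → Point → Point → Bool
  separableᵇ admissible p q r s = any (tryᵇ admissible p q r s) (directions p q r s)

  separable-sound : ∀ admissible p q r s → separableᵇ admissible p q r s ≡ true →
                    Σ (Separated p q r s) λ sep → admissible (Separated.α sep) ≡ true
  separable-sound admissible p q r s e with any-∈ (tryᵇ admissible p q r s) (directions p q r s) e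
  ... | d , _ , ok with ∧-true {admissible (proj₁ d)} ok
  ...   | adm , sep = separates-sound p q r s (proj₁ d) (proj₂ d) (offset p q d) sep , adm

  shift : ℤ → Point → Point
  shift d (x , y) = d ℤ.+ x , y

  separated-shift : ∀ d {p q r s} → Separated p q r s → Separated (shift d p) (shift d q) (shift d r) (shift d s)
  separated-shift d {p} {q} {r} {s} (separated α β γ p≥ q≥ r< s<) = separated α β (γ ℤ.- α ℤ.* d)
    (subst (0ℤ ℤ.≤_) (sym (moved p)) p≥) (subst (0ℤ ℤ.≤_) (sym (moved q)) q≥)
    (subst (ℤ._< 0ℤ) (sym (moved r)) r<) (subst (ℤ._< 0ℤ) (sym (moved s)) s<)
    where
    identity : ∀ α β γ d x y → α ℤ.* (d ℤ.+ x) ℤ.+ β ℤ.* y ℤ.+ (γ ℤ.- α ℤ.* d) ≡ α ℤ.* x ℤ.+ β ℤ.* y ℤ.+ γ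
    identity = solve-∀
    moved : ∀ p → lin α β (γ ℤ.- α ℤ.* d) (shift d p) ≡ lin α β γ p
    moved (x , y) = identity α β γ d x y

  lin-slide : ∀ α β γ x x′ y → lin α β γ (x′ , y) ≡ lin α β γ (x , y) ℤ.+ α ℤ.* (x′ ℤ.- x)
  lin-slide = identity
    where
    identity : ∀ α β γ x x′ y → α ℤ.* x′ ℤ.+ β ℤ.* y ℤ.+ γ ≡ (α ℤ.* x ℤ.+ β ℤ.* y ℤ.+ γ) ℤ.+ α ℤ.* (x′ ℤ.- x)
    identity = solve-∀

  -- The form does not decrease towards the right, so a separated point may be prolonged to a
  -- horizontal segment of any length. A closing link, whose length grows with the ring, is thereby
  -- reduced to one test at its end.
  slide-right : ∀ {x y r s} x′ (sep : Separated (x , y) (x , y) r s) → 0ℤ ℤ.≤ Separated.α sep → x ℤ.≤ x′ → Separated (x , y) (x′ , y) r s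
  slide-right {x} {y} x′ (separated α β γ p≥ _ r< s<) 0≤α x≤x′ = separated α β γ p≥
    (subst (0ℤ ℤ.≤_) (sym (lin-slide α β γ x x′ y)) (ℤ.+-mono-≤ p≥ (0≤* 0≤α (ℤ.i≤j⇒0≤j-i x≤x′)))) r< s<

  slide-left : ∀ {x y r s} x′ (sep : Separated (x , y) (x , y) r s) → 0ℤ ℤ.≤ ℤ.- Separated.α sep → x′ ℤ.≤ x → Separated (x , y) (x′ , y) r s
  slide-left {x} {y} x′ (separated α β γ p≥ _ r< s<) 0≤-α x′≤x = separated α β γ p≥
    (subst (0ℤ ℤ.≤_) (sym (trans (lin-slide α β γ x x′ y) (cong (ℤ._+_ (lin α β γ (x , y))) (swap-signs α x x′)))) (ℤ.+-mono-≤ p≥ (0≤* 0≤-α (ℤ.i≤j⇒0≤j-i x′≤x)))) r< s<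
    where
    swap-signs : ∀ α x x′ → α ℤ.* (x′ ℤ.- x) ≡ (ℤ.- α) ℤ.* (x ℤ.- x′)
    swap-signs = solve-∀

  separate-below : ∀ α β u {p q r s} → ℤ.- lin α β 0ℤ p ℤ.≤ u → ℤ.- lin α β 0ℤ q ℤ.≤ u → u ℤ.< ℤ.- lin α β 0ℤ r → u ℤ.< ℤ.- lin α β 0ℤ s → Separated p q r s
  separate-below α β u {p} {q} {r} {s} p≤ q≤ <r <s = separated α β u (nonneg p p≤) (nonneg q q≤) (neg r <r) (neg s <s)
    where
    identity : ∀ α β γ x y → γ ℤ.- ℤ.- (α ℤ.* x ℤ.+ β ℤ.* y ℤ.+ 0ℤ) ≡ α ℤ.* x ℤ.+ β ℤ.* y ℤ.+ γ
    identity = solve-∀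
    nonneg : ∀ p → ℤ.- lin α β 0ℤ p ℤ.≤ u → 0ℤ ℤ.≤ lin α β u p
    nonneg (x , y) p≤ = subst (0ℤ ℤ.≤_) (identity α β u x y) (ℤ.i≤j⇒0≤j-i p≤)
    neg : ∀ p → u ℤ.< ℤ.- lin α β 0ℤ p → lin α β u p ℤ.< 0ℤ
    neg (x , y) u< = subst₂ ℤ._<_ (identity α β u x y) (ℤ.+-inverseʳ (ℤ.- lin α β 0ℤ (x , y))) (ℤ.+-monoˡ-< (ℤ.- ℤ.- lin α β 0ℤ (x , y)) u<)

  separate-x : ∀ u {px py qx qy rx ry sx sy} → px ≤ u → qx ≤ u → u < rx → u < sx →
               Separated (+ px , py) (+ qx , qy) (+ rx , ry) (+ sx , sy)
  separate-x u {px} {py} {qx} {qy} {rx} {ry} {sx} {sy} p≤ q≤ <r <s = separate-below -1ℤ 0ℤ (+ u)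
    (subst (ℤ._≤ + u) (sym (x-of (+ px) py)) (ℤ.+≤+ p≤)) (subst (ℤ._≤ + u) (sym (x-of (+ qx) qy)) (ℤ.+≤+ q≤))
    (subst (+ u ℤ.<_) (sym (x-of (+ rx) ry)) (ℤ.+<+ <r)) (subst (+ u ℤ.<_) (sym (x-of (+ sx) sy)) (ℤ.+<+ <s))
    where
    x-of : ∀ x y → ℤ.- (-1ℤ ℤ.* x ℤ.+ 0ℤ ℤ.* y ℤ.+ 0ℤ) ≡ x
    x-of = solve-∀

  separate-y : ∀ u {px py qx qy rx ry sx sy} → py ≤ u → qy ≤ u → u < ry → u < sy →
               Separated (px , + py) (qx , + qy) (rx , + ry) (sx , + sy)
  separate-y u {px} {py} {qx} {qy} {rx} {ry} {sx} {sy} p≤ q≤ <r <s = separate-below 0ℤ -1ℤ (+ u)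
    (subst (ℤ._≤ + u) (sym (y-of px (+ py))) (ℤ.+≤+ p≤)) (subst (ℤ._≤ + u) (sym (y-of qx (+ qy))) (ℤ.+≤+ q≤))
    (subst (+ u ℤ.<_) (sym (y-of rx (+ ry))) (ℤ.+<+ <r)) (subst (+ u ℤ.<_) (sym (y-of sx (+ sy))) (ℤ.+<+ <s))
    where
    y-of : ∀ x y → ℤ.- (0ℤ ℤ.* x ℤ.+ -1ℤ ℤ.* y ℤ.+ 0ℤ) ≡ y
    y-of = solve-∀

  resolve : ∀ {x y} → x ∨ y ≡ true → (x ≡ true → ⊥) → y ≡ true
  resolve {true} _ ¬x = ⊥-elim (¬x refl)
  resolve {false} y _ = y

  -- The blocks stand in a row. The first and the last one have all six attachments on the side facing the row, the
  -- three of them without a neighbour in the row on top, so that the links closing the ring run above the middle blocks.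
  data Kind : Set where
    first middle last : Kind

  -- A link between neighbours in the row starts at any block but the last and, by `End`, ends at
  -- any block but the first.
  data Start : Kind → Set where
    first : Start first
    middle : Start middle

  data End : Kind → Set where
    middle : End middle
    last : End last

  -- Horizontal coordinates within a block are at most 49, so this spacing leaves an empty vertical
  -- strip between neighbouring blocks.
  width : ℕ
  width = 60

  at : ℕ → ℕ × ℕ → Point
  at o (x , y) = + (o + x) , + y

  record Layout (B : Shape) : Set where
    open Shape B
    field
      coords : Kind → Vertex → ℕ × ℕ

    X : Kind → Vertex → ℕ
    X κ a = proj₁ (coords κ a)

    Y : Kind → Vertex → ℕ
    Y κ a = proj₂ (coords κ a)

    field
      inner-apart : ∀ κ {a b c d} → (a , b) ∈ edges → (c , d) ∈ edges → c ≢ a → c ≢ b → d ≢ a → d ≢ b →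
        Separated (at 0 (coords κ a)) (at 0 (coords κ b)) (at 0 (coords κ c)) (at 0 (coords κ d))
      link-apart : ∀ {κ μ} → Start κ → End μ → ∀ e f → e ≢ f →
        Separated (at 0 (coords κ (right e))) (at width (coords μ (left e))) (at 0 (coords κ (right f))) (at width (coords μ (left f)))
      link-apart-here : ∀ {κ μ} → Start κ → End μ → ∀ e {c d} → (c , d) ∈ edges → right e ≢ c → right e ≢ d →
        Separated (at 0 (coords κ (right e))) (at width (coords μ (left e))) (at 0 (coords κ c)) (at 0 (coords κ d))
      link-apart-there : ∀ {κ μ} → Start κ → End μ → ∀ e {c d} → (c , d) ∈ edges → left e ≢ c → left e ≢ d →
        Separated (at 0 (coords κ (right e))) (at width (coords μ (left e))) (at width (coords μ c)) (at width (coords μ d))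
      -- Seen from the first block, closing links run to the right; seen from the last, to the left.
      -- Only their end in the block is tested, with a slope that permits sliding.
      ray-right : ∀ e {c d} → (c , d) ∈ edges → left e ≢ c → left e ≢ d →
        Σ (Separated (at 0 (coords first (left e))) (at 0 (coords first (left e))) (at 0 (coords first c)) (at 0 (coords first d)))
          λ sep → 0ℤ ℤ.≤ Separated.α sep
      ray-left : ∀ e {c d} → (c , d) ∈ edges → right e ≢ c → right e ≢ d →
        Σ (Separated (at 0 (coords last (right e))) (at 0 (coords last (right e))) (at 0 (coords last c)) (at 0 (coords last d)))
          λ sep → 0ℤ ℤ.≤ ℤ.- Separated.α sep
      X≤49 : ∀ κ a → X κ a ≤ 49
      -- In a middle block the vertical line at 9 parts the ends of the arriving links from those of
      -- the departing ones.
      middle-left : ∀ e → X middle (left e) ≤ 9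
      middle-right : ∀ e → 9 < X middle (right e)
      -- Height 7 is a ceiling for the middle blocks and for all links within the row; the closing
      -- links run strictly above it.
      middle-low : ∀ a → Y middle a ≤ 7
      start-low : ∀ {κ} → Start κ → ∀ e → Y κ (right e) ≤ 7
      end-low : ∀ {κ} → End κ → ∀ e → Y κ (left e) ≤ 7
      closing-high : ∀ e → 7 < Y first (left e)
      closing-level : ∀ e → Y last (right e) ≡ Y first (left e)
      closing-distinct : ∀ e f → e ≢ f → Y first (left e) ≢ Y first (left f)

  module CheckLayout (B : Shape) (coords : Kind → Shape.Vertex B → ℕ × ℕ) where
    open Shape B

    always : ℤ → Bool
    always _ = true

    touch : Vertex × Vertex → Vertex → Bool
    touch e a = (proj₁ e == a) ∨ (proj₂ e == a)

    touch-≢ : ∀ {e : Vertex × Vertex} {a} → a ≢ proj₁ e → a ≢ proj₂ e → touch e a ≡ true → ⊥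
    touch-≢ {e} {a} a≢₁ a≢₂ t = [ (λ x → a≢₁ (sym (==⇒≡ x))) , (λ x → a≢₂ (sym (==⇒≡ x))) ]′ (∨-true {proj₁ e == a} t)

    untouched : ∀ {e : Vertex × Vertex} {a b} → a ≢ proj₁ e → a ≢ proj₂ e → b ≢ proj₁ e → b ≢ proj₂ e →
                touch e a ∨ touch e b ≡ true → ⊥
    untouched {e} {a} a≢₁ a≢₂ b≢₁ b≢₂ t = [ touch-≢ a≢₁ a≢₂ , touch-≢ b≢₁ b≢₂ ]′ (∨-true {touch e a} t)

    innerPairᵇ : Kind → Vertex × Vertex → Vertex × Vertex → Bool
    innerPairᵇ κ e f = (touch e (proj₁ f) ∨ touch e (proj₂ f)) ∨
      separableᵇ always (at 0 (coords κ (proj₁ e))) (at 0 (coords κ (proj₂ e))) (at 0 (coords κ (proj₁ f))) (at 0 (coords κ (proj₂ f)))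

    linkPairᵇ : Kind → Kind → Fin 3 → Fin 3 → Bool
    linkPairᵇ κ μ e f = (e == f) ∨
      separableᵇ always (at 0 (coords κ (right e))) (at width (coords μ (left e))) (at 0 (coords κ (right f))) (at width (coords μ (left f)))

    linkHereᵇ : Kind → Kind → Fin 3 → Vertex × Vertex → Bool
    linkHereᵇ κ μ e f = touch f (right e) ∨
      separableᵇ always (at 0 (coords κ (right e))) (at width (coords μ (left e))) (at 0 (coords κ (proj₁ f))) (at 0 (coords κ (proj₂ f)))

    linkThereᵇ : Kind → Kind → Fin 3 → Vertex × Vertex → Bool
    linkThereᵇ κ μ e f = touch f (left e) ∨
      separableᵇ always (at 0 (coords κ (right e))) (at width (coords μ (left e))) (at width (coords μ (proj₁ f))) (at width (coords μ (proj₂ f)))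

    rayᵇ : (ℤ → Bool) → Kind → Vertex → Vertex × Vertex → Bool
    rayᵇ admissible κ a f = touch f a ∨
      separableᵇ admissible (at 0 (coords κ a)) (at 0 (coords κ a)) (at 0 (coords κ (proj₁ f))) (at 0 (coords κ (proj₂ f)))

    rightward leftward : ℤ → Bool
    rightward α = ⌊ 0ℤ ℤ.≤? α ⌋
    leftward α = ⌊ 0ℤ ℤ.≤? (ℤ.- α) ⌋

    Everywhere : (Kind → Bool) → Set
    Everywhere q = ∀ κ → q κ ≡ true

    LinksOnto : (Kind → Kind → Bool) → Set
    LinksOnto q = ∀ {κ μ} → Start κ → End μ → q κ μ ≡ true

    record Checked : Set where
      field
        innerᶜ : Everywhere λ κ → all (λ e → all (innerPairᵇ κ e) edges) edges
        linkᶜ : LinksOnto λ κ μ → allF (λ e → allF (linkPairᵇ κ μ e))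
        hereᶜ : LinksOnto λ κ μ → allF (λ e → all (linkHereᵇ κ μ e) edges)
        thereᶜ : LinksOnto λ κ μ → allF (λ e → all (linkThereᵇ κ μ e) edges)
        ray-rightᶜ : allF (λ e → all (rayᵇ rightward first (left e)) edges) ≡ true
        ray-leftᶜ : allF (λ e → all (rayᵇ leftward last (right e)) edges) ≡ true
        widthᶜ : Everywhere λ κ → allF (λ a → proj₁ (coords κ a) ≤ᵇ 49)
        middle-leftᶜ : allF (λ e → proj₁ (coords middle (left e)) ≤ᵇ 9) ≡ true
        middle-rightᶜ : allF (λ e → 10 ≤ᵇ proj₁ (coords middle (right e))) ≡ true
        middle-lowᶜ : allF (λ a → proj₂ (coords middle a) ≤ᵇ 7) ≡ true
        start-lowᶜ : ∀ {κ} → Start κ → allF (λ e → proj₂ (coords κ (right e)) ≤ᵇ 7) ≡ true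
        end-lowᶜ : ∀ {κ} → End κ → allF (λ e → proj₂ (coords κ (left e)) ≤ᵇ 7) ≡ true
        closing-highᶜ : allF (λ e → 8 ≤ᵇ proj₂ (coords first (left e))) ≡ true
        closing-levelᶜ : allF (λ e → proj₂ (coords last (right e)) ≡ᵇ proj₂ (coords first (left e))) ≡ true
        closing-distinctᶜ : allF (λ e → allF λ f → (e == f) ∨ not (proj₂ (coords first (left e)) ≡ᵇ proj₂ (coords first (left f)))) ≡ true

    checked⇒layout : Checked → Layout B
    checked⇒layout checked = record
      { coords = coords
      ; inner-apart = λ κ {a} {b} {c} {d} ab cd c≢a c≢b d≢a d≢b → proj₁ (separable-sound always
          (at 0 (coords κ a)) (at 0 (coords κ b)) (at 0 (coords κ c)) (at 0 (coords κ d))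
          (resolve {touch (a , b) c ∨ touch (a , b) d}
            (all-∈ (innerPairᵇ κ (a , b)) (all-∈ (λ e → all (innerPairᵇ κ e) edges) (innerᶜ κ) ab) cd)
            (untouched c≢a c≢b d≢a d≢b)))
      ; link-apart = λ {κ} {μ} s t e f e≢f → proj₁ (separable-sound always
          (at 0 (coords κ (right e))) (at width (coords μ (left e))) (at 0 (coords κ (right f))) (at width (coords μ (left f)))
          (resolve {e == f} (allF₂-sound (linkPairᵇ κ μ) (linkᶜ s t) e f) λ same → e≢f (==⇒≡ same)))
      ; link-apart-here = λ {κ} {μ} s t e {c} {d} cd e≢c e≢d → proj₁ (separable-sound always
          (at 0 (coords κ (right e))) (at width (coords μ (left e))) (at 0 (coords κ c)) (at 0 (coords κ d))
          (resolve {touch (c , d) (right e)}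
            (all-∈ (linkHereᵇ κ μ e) (allF-sound (λ e → all (linkHereᵇ κ μ e) edges) (hereᶜ s t) e) cd) (touch-≢ e≢c e≢d)))
      ; link-apart-there = λ {κ} {μ} s t e {c} {d} cd e≢c e≢d → proj₁ (separable-sound always
          (at 0 (coords κ (right e))) (at width (coords μ (left e))) (at width (coords μ c)) (at width (coords μ d))
          (resolve {touch (c , d) (left e)}
            (all-∈ (linkThereᵇ κ μ e) (allF-sound (λ e → all (linkThereᵇ κ μ e) edges) (thereᶜ s t) e) cd) (touch-≢ e≢c e≢d)))
      ; ray-right = λ e {c} {d} cd e≢c e≢d → ray rightward first (left e) (λ _ → ⌊⌋-sound)
          (all-∈ (rayᵇ rightward first (left e)) (allF-sound (λ e → all (rayᵇ rightward first (left e)) edges) ray-rightᶜ e) cd) e≢c e≢d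
      ; ray-left = λ e {c} {d} cd e≢c e≢d → ray leftward last (right e) (λ _ → ⌊⌋-sound)
          (all-∈ (rayᵇ leftward last (right e)) (allF-sound (λ e → all (rayᵇ leftward last (right e)) edges) ray-leftᶜ e) cd) e≢c e≢d
      ; X≤49 = λ κ a → ≤ᵇ-sound (allF-sound (λ a → proj₁ (coords κ a) ≤ᵇ 49) (widthᶜ κ) a)
      ; middle-left = λ e → ≤ᵇ-sound (allF-sound (λ e → proj₁ (coords middle (left e)) ≤ᵇ 9) middle-leftᶜ e)
      ; middle-right = λ e → ≤ᵇ-sound (allF-sound (λ e → 10 ≤ᵇ proj₁ (coords middle (right e))) middle-rightᶜ e)
      ; middle-low = λ a → ≤ᵇ-sound (allF-sound (λ a → proj₂ (coords middle a) ≤ᵇ 7) middle-lowᶜ a)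
      ; start-low = λ {κ} s e → ≤ᵇ-sound (allF-sound (λ e → proj₂ (coords κ (right e)) ≤ᵇ 7) (start-lowᶜ s) e)
      ; end-low = λ {κ} t e → ≤ᵇ-sound (allF-sound (λ e → proj₂ (coords κ (left e)) ≤ᵇ 7) (end-lowᶜ t) e)
      ; closing-high = λ e → ≤ᵇ-sound (allF-sound (λ e → 8 ≤ᵇ proj₂ (coords first (left e))) closing-highᶜ e)
      ; closing-level = λ e → ≡ᵇ-sound (allF-sound (λ e → proj₂ (coords last (right e)) ≡ᵇ proj₂ (coords first (left e))) closing-levelᶜ e)
      ; closing-distinct = λ e f e≢f same → not-both (≡⇒≡ᵇ _ _ same)
          (resolve {e == f} (allF₂-sound (λ e f → (e == f) ∨ not (proj₂ (coords first (left e)) ≡ᵇ proj₂ (coords first (left f)))) closing-distinctᶜ e f)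
            λ x → e≢f (==⇒≡ x))
      }
      where
      open Checked checked
      ray : ∀ {P : ℤ → Set} admissible κ a → (∀ α → admissible α ≡ true → P α) → ∀ {c d} → rayᵇ admissible κ a (c , d) ≡ true → a ≢ c → a ≢ d →
        Σ (Separated (at 0 (coords κ a)) (at 0 (coords κ a)) (at 0 (coords κ c)) (at 0 (coords κ d))) λ sep → P (Separated.α sep)
      ray admissible κ a sound {c} {d} e a≢c a≢d = proj₁ found , sound _ (proj₂ found)
        where
        found = separable-sound admissible (at 0 (coords κ a)) (at 0 (coords κ a)) (at 0 (coords κ c)) (at 0 (coords κ d))
          (resolve {touch (c , d) a} e (touch-≢ a≢c a≢d))
      not-both : ∀ {b} → T b → not b ≡ true → ⊥
      not-both {true} _ ()

-- The straight-line drawing of the whole ring.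

module PlaneDrawings where

  open import Defs hiding (sym)
  open Sums
  open Blocks
  open Necklaces
  open Separation
  open Layouts
  open import Data.Bool using (Bool; true; false; if_then_else_)
  open import Data.Empty using (⊥-elim)
  open import Data.Fin using (Fin; zero; suc; toℕ; fromℕ; inject₁)
  open import Data.Fin.Relation.Unary.Top using (view; ‵fromℕ; ‵inject₁; view-fromℕ; view-inject₁)
  import Data.Fin as F
  import Data.Fin.Properties as FP
  open import Data.Integer as ℤ using (ℤ; +_; 0ℤ)
  import Data.Integer.Properties as ℤ
  open import Data.List.Membership.Propositional using (_∈_)
  open import Data.Nat hiding (_<?_)
  open import Data.Nat.Properties hiding (_<?_; _≟_)
  open import Data.Product using (_×_; _,_; ∃; proj₁; proj₂; uncurry)
  open import Data.Sum using (_⊎_; inj₁; inj₂)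
  open import Relation.Nullary using (¬_; yes; no; contradiction)
  open import Relation.Nullary.Decidable using (_×-dec_; ¬?)
  open import Relation.Binary.PropositionalEquality
  open import Relation.Binary.Definitions using (tri<; tri≈; tri>)

  module _ (G : Graph) (regular : Regular 4 G) (pos : Fin (n G) → Point)
    (noCrossings : ∀ p q r s → adj G p q ≡ true → adj G r s ≡ true → r ≢ p → r ≢ q → s ≢ p → s ≢ q →
                   ¬ SegIntersect (pos p) (pos q) (pos r) (pos s)) where

    -- Through a vertex lying on an edge there is an edge that avoids both ends of the first. Hence
    -- `noCrossings` implies the two other conditions of a plane drawing, and only disjointness of
    -- edges has to be shown for the ring.
    another-neighbour : ∀ r p q → ∃ λ s → adj G r s ≡ true × s ≢ p × s ≢ q
    another-neighbour r p q with FP.any? (λ s → (adj G r s Data.Bool.≟ true) ×-dec (¬? (s F.≟ p) ×-dec ¬? (s F.≟ q)))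
    ... | yes found = found
    ... | no none = contradiction (subst (_≤ 2) (regular r) (begin
        count (adj G r) ≡⟨ count≡sum (adj G r) ⟩
        sumF (λ s → ind (adj G r s)) ≤⟨ sum-mono among ⟩
        sumF (λ s → (if s == p then 1 else 0) + (if s == q then 1 else 0)) ≡⟨ sum-+ {n G} _ _ ⟩
        sumF (λ s → if s == p then 1 else 0) + sumF (λ s → if s == q then 1 else 0) ≡⟨ cong₂ _+_ (sum-δ p (λ _ → 1)) (sum-δ q (λ _ → 1)) ⟩
        2 ∎)) λ { (s≤s (s≤s ())) }
      where
      open ≤-Reasoning
      among : ∀ s → ind (adj G r s) ≤ (if s == p then 1 else 0) + (if s == q then 1 else 0)
      among s with adj G r s in rs | s F.≟ p | s F.≟ q
      ... | false | _ | _ = z≤n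
      ... | true | yes _ | _ = s≤s z≤n
      ... | true | no _ | yes _ = s≤s z≤n
      ... | true | no s≢p | no s≢q = contradiction (s , rs , s≢p , s≢q) none

    offEdges : ∀ p q r → adj G p q ≡ true → r ≢ p → r ≢ q → ¬ OnSeg (pos p) (pos q) (pos r)
    offEdges p q r pq r≢p r≢q on with another-neighbour r p q
    ... | s , rs , s≢p , s≢q = noCrossings p q r s pq rs r≢p r≢q s≢p s≢q (inj₂ (inj₁ on))

    onSeg-start : ∀ p q → OnSeg p q p
    onSeg-start (px , py) (qx , qy) = flat , ℤ.i⊓j≤i px qx , ℤ.i≤i⊔j px qx , ℤ.i⊓j≤i py qy , ℤ.i≤i⊔j py qy
      where
      flat : orient (px , py) (qx , qy) (px , py) ≡ 0ℤ
      flat rewrite ℤ.+-inverseʳ py | ℤ.+-inverseʳ px | ℤ.*-zeroʳ (qx ℤ.- px) | ℤ.*-zeroʳ (qy ℤ.- py) = refl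

    drawing : PlaneDrawing G
    drawing = record { pos = pos ; injective = injective ; offEdges = offEdges ; noCrossings = noCrossings }
      where
      injective : ∀ i j → pos i ≡ pos j → i ≡ j
      injective i j e with i F.≟ j
      ... | yes i≡j = i≡j
      -- Some edge at `i` avoids `j`. If the positions coincide, `j` lies on that edge, at its
      -- start.
      ... | no i≢j with another-neighbour i j j
      ...   | s , is , s≢j , _ = ⊥-elim (offEdges i s j is (λ j≡i → i≢j (sym j≡i)) (λ j≡s → s≢j (sym j≡s))
                (subst (OnSeg (pos i) (pos s)) e (onSeg-start (pos i) (pos s))))

  module _ (m : ℕ) (B : Shape) (good : Sturdy B) (drawn : Layout B) where

    open Cyclic (cyclic m)
    open Shape B
    open Layout drawn
    open Necklace (cyclic m) B good

    private
      k = 3 + m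

    kind : Fin k → Kind
    kind zero = first
    kind (suc i) with view i
    ... | ‵fromℕ = last
    ... | ‵inject₁ _ = middle

    data Location : Fin k → Kind → Set where
      at-first : Location zero first
      at-middle : ∀ {i} → Location i middle
      at-last : Location (fromℕ (2 + m)) last

    locate : ∀ i → Location i (kind i)
    locate zero = at-first
    locate (suc i) with view i
    ... | ‵fromℕ = at-last
    ... | ‵inject₁ _ = at-middle

    data Step : Fin k → Fin k → Set where
      onward : ∀ {i j} → toℕ j ≡ suc (toℕ i) → Start (kind i) → End (kind j) → Step i j
      around : Step (fromℕ (2 + m)) zero

    next-step : ∀ i → Step i (next i)
    next-step i with view i
    ... | ‵fromℕ = around
    ... | ‵inject₁ j = onward (cong suc (sym (FP.toℕ-inject₁ j))) (starts j) (ends j)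
      where
      starts : ∀ (j : Fin (2 + m)) → Start (kind (inject₁ j))
      starts zero = first
      starts (suc j) rewrite view-inject₁ j = middle
      ends : ∀ (j : Fin (2 + m)) → End (kind (suc j))
      ends j with view j
      ... | ‵fromℕ = last
      ... | ‵inject₁ _ = middle

    kind-last : kind (fromℕ (2 + m)) ≡ last
    kind-last rewrite view-fromℕ m = refl

    corner : Fin k → ℕ
    corner i = toℕ i * width

    place : Place → Point
    place (i , a) = at (corner i) (coords (kind i) a)

    -- Each edge in one chosen orientation. A separation can be flipped within either pair, so the
    -- four combinations of orientations reduce to one.
    data Edge : Place → Place → Set where
      inside : ∀ i {a b} → (a , b) ∈ edges → Edge (i , a) (i , b)
      along : ∀ i e → Edge (i , right e) (next i , left e)

    edge : ∀ {p q} → Adjacent p q → Edge p q ⊎ Edge q p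
    edge (forth i e) = inj₁ (along i e)
    edge (back i e) = inj₂ (along i e)
    edge (inside {i} {a} {b} ab) with inner-edge {a} {b} ab
    ... | inj₁ ab∈ = inj₁ (inside i ab∈)
    ... | inj₂ ba∈ = inj₂ (inside i ba∈)

    module _ where
      open ≤-Reasoning

      block-end : ∀ i a → corner i + X (kind i) a ≤ corner i + 49
      block-end i a = +-monoʳ-≤ (corner i) (X≤49 (kind i) a)

      block-start : ∀ i a {x} → x < corner i → x < corner i + X (kind i) a
      block-start i a x< = <-≤-trans x< (m≤m+n _ _)

      corner-< : ∀ {i j} → toℕ i < toℕ j → corner i + 49 < corner j
      corner-< {i} {j} i<j = begin-strict
        corner i + 49 <⟨ +-monoʳ-< (corner i) (≤-trans (n≤1+n 50) (m≤m+n 51 9)) ⟩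
        corner i + width ≡⟨ +-comm (corner i) width ⟩
        suc (toℕ i) * width ≤⟨ *-monoˡ-≤ width i<j ⟩
        corner j ∎

    Apart : Place → Place → Place → Place → Set
    Apart p q r s = Separated (place p) (place q) (place r) (place s)

    blocks-apart : ∀ {i j a b c d i′ j′} → toℕ i ≤ toℕ i′ → toℕ i′ < toℕ j → toℕ j ≤ toℕ j′ →
                   Apart (i , a) (i′ , b) (j , c) (j′ , d)
    blocks-apart {i} {j} {a} {b} {c} {d} {i′} {j′} i≤i′ i′<j j≤j′ = separate-x (corner i′ + 49)
      (≤-trans (block-end i a) (+-monoˡ-≤ 49 (*-monoˡ-≤ width i≤i′))) (block-end i′ b)
      (block-start j c (corner-< {i′} {j} i′<j)) (block-start j′ d (<-≤-trans (corner-< {i′} {j} i′<j) (*-monoˡ-≤ width j≤j′)))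

    shift-there : ∀ {i j} → toℕ j ≡ suc (toℕ i) → ∀ a → shift (+ corner i) (at width (coords (kind j) a)) ≡ place (j , a)
    shift-there {i} {j} e a = cong (λ x → + x , + Y (kind j) a) (trans (sym (+-assoc (corner i) width _))
      (cong (_+ X (kind j) a) (trans (+-comm (corner i) width) (cong (_* width) {suc (toℕ i)} {toℕ j} (sym e)))))

    inner-inner : ∀ i {a b c d} → (a , b) ∈ edges → (c , d) ∈ edges → c ≢ a → c ≢ b → d ≢ a → d ≢ b →
                  Apart (i , a) (i , b) (i , c) (i , d)
    inner-inner i ab cd c≢a c≢b d≢a d≢b = separated-shift (+ corner i) (inner-apart (kind i) ab cd c≢a c≢b d≢a d≢b)

    module _ {i j} (j≡1+i : toℕ j ≡ suc (toℕ i)) (start : Start (kind i)) (end : End (kind j)) where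

      along-along : ∀ e f → e ≢ f → Apart (i , right e) (j , left e) (i , right f) (j , left f)
      along-along e f e≢f = subst₂ (λ q s → Separated (place (i , right e)) q (place (i , right f)) s)
        (shift-there {i} {j} j≡1+i (left e)) (shift-there {i} {j} j≡1+i (left f))
        (separated-shift (+ corner i) (link-apart start end e f e≢f))

      along-here : ∀ e {c d} → (c , d) ∈ edges → right e ≢ c → right e ≢ d → Apart (i , right e) (j , left e) (i , c) (i , d)
      along-here e {c} {d} cd e≢c e≢d = subst (λ q → Separated (place (i , right e)) q (place (i , c)) (place (i , d)))
        (shift-there {i} {j} j≡1+i (left e)) (separated-shift (+ corner i) (link-apart-here start end e cd e≢c e≢d))

      along-there : ∀ e {c d} → (c , d) ∈ edges → left e ≢ c → left e ≢ d → Apart (i , right e) (j , left e) (j , c) (j , d)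
      along-there e {c} {d} cd e≢c e≢d = subst₂ (λ q rs → Separated (place (i , right e)) q (proj₁ rs) (proj₂ rs))
        (shift-there {i} {j} j≡1+i (left e)) (cong₂ _,_ (shift-there {i} {j} j≡1+i c) (shift-there {i} {j} j≡1+i d))
        (separated-shift (+ corner i) (link-apart-there start end e cd e≢c e≢d))

    kind≡middle : ∀ {i} → Start (kind i) → End (kind i) → kind i ≡ middle
    kind≡middle {i} s e with kind i
    kind≡middle middle middle | .middle = refl

    -- Block `j` receives one link and sends the other, so it is a middle block, and its vertical
    -- line at 9 separates them.
    consecutive-along : ∀ {i j l} e f → toℕ j ≡ suc (toℕ i) → End (kind j) → Start (kind j) → toℕ l ≡ suc (toℕ j) →
                        Apart (i , right e) (j , left e) (j , right f) (l , left f)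
    consecutive-along {i} {j} {l} e f j≡1+i end start l≡1+j = separate-x (corner j + 9)
      (≤-trans (block-end i (right e)) (≤-trans (<⇒≤ (corner-< {i} {j} (≤-reflexive (sym j≡1+i)))) (m≤m+n _ 9)))
      (+-monoʳ-≤ (corner j) (subst (λ κ → X κ (left e) ≤ 9) (sym j-middle) (middle-left e)))
      (+-monoʳ-< (corner j) (subst (λ κ → 9 < X κ (right f)) (sym j-middle) (middle-right f)))
      (block-start l (left f) (≤-<-trans (+-monoʳ-≤ (corner j) (m≤m+n 9 40)) (corner-< {j} {l} (≤-reflexive (sym l≡1+j)))))
      where
      j-middle = kind≡middle {j} start end

    top = fromℕ (2 + m)

    closing-y : ∀ e → Y (kind top) (right e) ≡ Y first (left e)
    closing-y e = trans (cong (λ κ → Y κ (right e)) kind-last) (closing-level e)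

    closing-top : ∀ e → 7 < Y (kind top) (right e)
    closing-top e = subst (7 <_) (sym (closing-y e)) (closing-high e)

    below-closing : ∀ e {p q} → Y (kind (proj₁ p)) (proj₂ p) ≤ 7 → Y (kind (proj₁ q)) (proj₂ q) ≤ 7 → Apart p q (top , right e) (zero , left e)
    below-closing e p≤ q≤ = separate-y 7 p≤ q≤ (closing-top e) (closing-high e)

    closing-length : ∀ e → + X first (left e) ℤ.≤ + (corner top + X (kind top) (right e))
    closing-length e = ℤ.+≤+ (begin
      X first (left e) ≤⟨ X≤49 first (left e) ⟩
      49 ≤⟨ m≤m+n 49 11 ⟩
      width ≤⟨ m≤m+n width _ ⟩
      corner top ≤⟨ m≤m+n _ _ ⟩
      corner top + X (kind top) (right e) ∎)
      where open ≤-Reasoning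

    -- A middle block lies below the closing link. Against the first or the last block the link is
    -- its own attachment there, prolonged horizontally; `closing-length` ensures that it extends in
    -- the tested direction.
    closing-inner : ∀ e j {c d} → (c , d) ∈ edges → (top , right e) ≢ (j , c) → (top , right e) ≢ (j , d) →
                    (zero , left e) ≢ (j , c) → (zero , left e) ≢ (j , d) → Apart (top , right e) (zero , left e) (j , c) (j , d)
    closing-inner e j {c} {d} cd r≢c r≢d l≢c l≢d = by-location (kind j) (locate j) refl
      where
      by-location : ∀ κ → Location j κ → kind j ≡ κ → Apart (top , right e) (zero , left e) (j , c) (j , d)
      by-location _ at-middle eq = flip-sides (below-closing e {j , c} {j , d} (subst (λ κ → Y κ c ≤ 7) (sym eq) (middle-low c)) (subst (λ κ → Y κ d ≤ 7) (sym eq) (middle-low d)))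
      by-location _ at-first _ = flip-first (subst (λ y → Separated (place (zero , left e)) (+ (corner top + X (kind top) (right e)) , + y) (place (zero , c)) (place (zero , d)))
        (sym (closing-y e)) (slide-right _ (proj₁ ray) (proj₂ ray) (closing-length e)))
        where
        ray = ray-right e cd (λ x → l≢c (cong (zero ,_) x)) (λ x → l≢d (cong (zero ,_) x))
      by-location _ at-last eq = subst (λ κ → Separated (at (corner top) (coords κ (right e))) (place (zero , left e)) (at (corner top) (coords κ c)) (at (corner top) (coords κ d))) (sym eq)
        (subst (λ y → Separated (at (corner top) (coords last (right e))) (+ X first (left e) , + y) (at (corner top) (coords last c)) (at (corner top) (coords last d))) (closing-level e)
          (slide-left _ (separated-shift (+ corner top) (proj₁ ray)) (proj₂ ray)
            (subst (λ κ → + X first (left e) ℤ.≤ + (corner top + X κ (right e))) eq (closing-length e))))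
        where
        ray = ray-left e cd (λ x → r≢c (cong (top ,_) x)) (λ x → r≢d (cong (top ,_) x))

    closing-closing : ∀ e f → e ≢ f → Apart (top , right e) (zero , left e) (top , right f) (zero , left f)
    closing-closing e f e≢f with <-cmp (Y first (left e)) (Y first (left f))
    ... | tri< e<f _ _ = separate-y (Y first (left e)) (≤-reflexive (closing-y e)) ≤-refl (subst (Y first (left e) <_) (sym (closing-y f)) e<f) e<f
    ... | tri> _ _ f<e = flip-sides (separate-y (Y first (left f)) (≤-reflexive (closing-y f)) ≤-refl (subst (Y first (left f) <_) (sym (closing-y e)) f<e) f<e)
    ... | tri≈ _ same _ = contradiction same (closing-distinct e f e≢f)

    along-inside : ∀ i e j {c d} → (c , d) ∈ edges → (i , right e) ≢ (j , c) → (i , right e) ≢ (j , d) →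
                   (next i , left e) ≢ (j , c) → (next i , left e) ≢ (j , d) → Apart (i , right e) (next i , left e) (j , c) (j , d)
    along-inside i e j {c} {d} cd r≢c r≢d l≢c l≢d = go (next-step i) r≢c r≢d l≢c l≢d
      where
      go : ∀ {i l} → Step i l → (i , right e) ≢ (j , c) → (i , right e) ≢ (j , d) →
           (l , left e) ≢ (j , c) → (l , left e) ≢ (j , d) → Apart (i , right e) (l , left e) (j , c) (j , d)
      go around r≢c r≢d l≢c l≢d = closing-inner e j cd r≢c r≢d l≢c l≢d
      go {i} {l} (onward l≡1+i start end) r≢c r≢d l≢c l≢d with FP.<-cmp j i
      ... | tri< j<i _ _ = flip-sides (blocks-apart {j} {i} {i′ = j} {j′ = l} ≤-refl j<i (≤-trans (n≤1+n _) (≤-reflexive (sym l≡1+i))))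
      ... | tri≈ _ refl _ = along-here l≡1+i start end e cd (λ x → r≢c (cong (i ,_) x)) (λ x → r≢d (cong (i ,_) x))
      ... | tri> _ _ i<j with FP.<-cmp l j
      ...   | tri< l<j _ _ = blocks-apart {i} {j} {i′ = l} {j′ = j} (≤-trans (n≤1+n _) (≤-reflexive (sym l≡1+i))) l<j ≤-refl
      ...   | tri≈ _ refl _ = along-there l≡1+i start end e cd (λ x → l≢c (cong (l ,_) x)) (λ x → l≢d (cong (l ,_) x))
      ...   | tri> _ _ j<l = contradiction (≤-trans j<l (≤-reflexive l≡1+i)) (≤⇒≯ i<j)

    -- A link is determined by its `right` end, so this single inequality says that the two links
    -- are different.
    along-along-any : ∀ i e j f → (i , right e) ≢ (j , right f) → Apart (i , right e) (next i , left e) (j , right f) (next j , left f)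
    along-along-any i e j f ends≢ = go (next-step i) (next-step j) ends≢
      where
      earlier : ∀ {i l j o} → toℕ l ≡ suc (toℕ i) → End (kind l) → Start (kind j) → toℕ o ≡ suc (toℕ j) → toℕ i < toℕ j →
                ∀ e f → Apart (i , right e) (l , left e) (j , right f) (o , left f)
      earlier {i} {l} {j} {o} l≡ end start o≡ i<j e f with FP.<-cmp l j
      ... | tri< l<j _ _ = blocks-apart {i} {j} {i′ = l} {j′ = o} (≤-trans (n≤1+n _) (≤-reflexive (sym l≡))) l<j (≤-trans (n≤1+n _) (≤-reflexive (sym o≡)))
      ... | tri≈ _ refl _ = consecutive-along e f l≡ end start o≡
      ... | tri> _ _ j<l = contradiction (≤-trans j<l (≤-reflexive l≡)) (≤⇒≯ i<j)
      go : ∀ {i l j o} → Step i l → Step j o → (i , right e) ≢ (j , right f) → Apart (i , right e) (l , left e) (j , right f) (o , left f)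
      go around around ends≢ = closing-closing e f λ { refl → ends≢ refl }
      go {j = j} {o} around (onward _ start end) _ = flip-sides (below-closing e {j , right f} {o , left f} (start-low start f) (end-low end f))
      go {i} {l} (onward _ start end) around _ = below-closing f {i , right e} {l , left e} (start-low start e) (end-low end e)
      go {i} {l} {j} {o} (onward l≡ s en) (onward o≡ s′ en′) ends≢ with FP.<-cmp i j
      ... | tri< i<j _ _ = earlier l≡ en s′ o≡ i<j e f
      ... | tri> _ _ j<i = flip-sides (earlier o≡ en′ s l≡ j<i f e)
      ... | tri≈ _ refl _ with refl ← FP.toℕ-injective (trans l≡ (sym o≡)) = along-along l≡ s en e f λ { refl → ends≢ refl }

    apart : ∀ {p q r s} → Edge p q → Edge r s → r ≢ p → r ≢ q → s ≢ p → s ≢ q → Apart p q r s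
    apart (along i e) (along j f) r≢p _ _ _ = along-along-any i e j f (λ x → r≢p (sym x))
    apart (along i e) (inside j cd) r≢p r≢q s≢p s≢q = along-inside i e j cd (λ x → r≢p (sym x)) (λ x → s≢p (sym x)) (λ x → r≢q (sym x)) (λ x → s≢q (sym x))
    apart (inside j cd) (along i e) r≢p r≢q s≢p s≢q = flip-sides (along-inside i e j cd r≢p r≢q s≢p s≢q)
    apart (inside i ab) (inside j cd) r≢p r≢q s≢p s≢q with FP.<-cmp i j
    ... | tri< i<j _ _ = blocks-apart {i} {j} ≤-refl i<j ≤-refl
    ... | tri> _ _ j<i = flip-sides (blocks-apart {j} {i} ≤-refl j<i ≤-refl)
    ... | tri≈ _ refl _ = inner-inner i ab cd (λ x → r≢p (cong (i ,_) x)) (λ x → r≢q (cong (i ,_) x)) (λ x → s≢p (cong (i ,_) x)) (λ x → s≢q (cong (i ,_) x))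

    apart-adjacent : ∀ {p q r s} → Adjacent p q → Adjacent r s → r ≢ p → r ≢ q → s ≢ p → s ≢ q → Apart p q r s
    apart-adjacent pq rs r≢p r≢q s≢p s≢q with edge pq | edge rs
    ... | inj₁ e | inj₁ f = apart e f r≢p r≢q s≢p s≢q
    ... | inj₂ e | inj₁ f = flip-first (apart e f r≢q r≢p s≢q s≢p)
    ... | inj₁ e | inj₂ f = flip-second (apart e f s≢p s≢q r≢p r≢q)
    ... | inj₂ e | inj₂ f = flip-first (flip-second (apart e f s≢q s≢p r≢q r≢p))

    planar : Planar necklace
    planar = drawing necklace regular (λ x → place (loc x)) λ p q r s pq rs r≢p r≢q s≢p s≢q →
      separated⇒disjoint (apart-adjacent (adjacent⇒ {loc p} {loc q} pq) (adjacent⇒ {loc r} {loc s} rs)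
        (loc-≢ r≢p) (loc-≢ r≢q) (loc-≢ s≢p) (loc-≢ s≢q))
      where
      loc-≢ : ∀ {x y} → x ≢ y → loc x ≢ loc y
      loc-≢ {x} {y} x≢y e = x≢y (trans (sym (⟨⟩-loc x)) (trans (cong (uncurry ⟨_,_⟩) e) (⟨⟩-loc y)))

-- The infinite family obtained from any suitable block.

module Family where

  open import Defs hiding (sym)
  open Blocks
  open Necklaces
  open Layouts
  open ClawDecompositions
  open EdgeCuts
  open VertexCuts
  open PlaneDrawings
  open import Data.Nat using (_+_; _*_; _≤_; _<_; s≤s; z≤n)
  open import Data.Nat.Divisibility using (_∣_; ∣m∣n⇒∣m+n; ∣m⇒∣m*n; ∣-refl; m∣m*n)
  open import Data.Nat.Properties using (≤-trans; m≤m+n; m≤n+m; m≤n*m; *-mono-≤; *-monoʳ-≤; *-identityʳ)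
  open import Data.Product using (Σ; _×_; _,_)
  open import Relation.Nullary using (¬_)
  open import Relation.Binary.PropositionalEquality using (subst; sym)

  Counterexample : Graph → Set
  Counterexample G = Planar G × KConnected 4 G × EssEdgeConnected 6 G ×
    Regular 4 G × 3 ∣ edgeCount G × ¬ ClawDecomposition G

  -- The length `3 + 3 * N` is at least three, as `cyclic` requires, exceeds `N`, and is a multiple
  -- of three, which carries over to the edge count `k * (size * 2)`.
  necklaces : ∀ B → Sturdy B → Layout B → 2 ≤ Shape.size B → ∀ N → Σ Graph λ G → N < n G × Counterexample G
  necklaces B good layout 2≤size N = necklace , large , planar (3 * N) B good layout ,
    k-connected ring B good (≤-trans (s≤s (s≤s (s≤s (s≤s (s≤s z≤n))))) (*-mono-≤ (m≤m+n 3 (3 * N)) 2≤size)) ,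
    ess-edge-connected ring B good , regular ,
    subst (3 ∣_) (sym edgeCount≡) (∣m⇒∣m*n (size * 2) (∣m∣n⇒∣m+n ∣-refl (m∣m*n N))) ,
    no-claw-decomposition ring B good (s≤s z≤n)
    where
    open Shape B
    ring = cyclic (3 * N)
    open Necklace ring B good
    large : N < (3 + 3 * N) * size
    large = ≤-trans (s≤s (≤-trans (m≤n*m N 3) (m≤n+m (3 * N) 2)))
      (subst (_≤ (3 + 3 * N) * size) (*-identityʳ (3 + 3 * N))
        (*-monoʳ-≤ (3 + 3 * N) (≤-trans (s≤s z≤n) 2≤size)))

-- Branch and bound over Boolean functions on a finite set.

module Search where

  open import Defs hiding (sym)
  open Sums
  open import Data.Bool using (Bool; true; false; _∧_; _∨_; _xor_; not)
  open import Data.Fin using (Fin)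
  import Data.Fin as F
  open import Data.List using (List; []; _∷_; reverse; allFin)
  open import Data.Maybe using (Maybe; just; nothing)
  open import Data.Nat
  open import Data.Nat.Properties hiding (_≟_)
  open import Data.Product using (_,_)
  open import Data.Sum using (inj₁; inj₂)
  open import Data.Vec using (Vec; []; _∷_; lookup; _[_]≔_; replicate)
  open import Data.Vec.Properties using (lookup∘update; lookup∘update′; lookup-replicate)
  open import Relation.Nullary using (yes; no)
  open import Relation.Binary.PropositionalEquality

  Partial : ℕ → Set
  Partial N = Vec (Maybe Bool) N

  is : Bool → Maybe Bool → Bool
  is b nothing = false
  is b (just c) = not (b xor c)

  is-just : ∀ {b m} → is b m ≡ true → m ≡ just b
  is-just {true} {just true} _ = refl
  is-just {false} {just false} _ = refl

  record Agrees {N} (p : Partial N) (f : Fin N → Bool) : Set where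
    field
      value : ∀ i {b} → lookup p i ≡ just b → f i ≡ b
  open Agrees public

  agrees-is : ∀ {N} {p : Partial N} {f} → Agrees p f → ∀ i {b} → is b (lookup p i) ≡ true → f i ≡ b
  agrees-is ag i e = value ag i (is-just e)

  extend : ∀ {N} {p : Partial N} {f v b} → Agrees p f → f v ≡ b → Agrees (p [ v ]≔ just b) f
  extend {p = p} {f} {v} {b} ag fv .value i q with i F.≟ v
  ... | no i≢v = value ag i (trans (sym (lookup∘update′ i≢v p (just b))) q)
  ... | yes refl with refl ← trans (sym (lookup∘update v p (just b))) q = fv

  -- settled p may hold only if the claim follows for all functions agreeing with p; the search branches elsewhere.
  module _ {N} (settled : Partial N → Bool) where

    search : List (Fin N) → Partial N → Bool
    search [] p = settled p
    search (v ∷ vs) p = settled p ∨ (search vs (p [ v ]≔ just true) ∧ search vs (p [ v ]≔ just false))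

    search-sound : ∀ {f} {P : Set} → (∀ p → Agrees p f → settled p ≡ true → P) →
                   ∀ vs p → Agrees p f → search vs p ≡ true → P
    search-sound sound [] p ag e = sound p ag e
    search-sound {f} sound (v ∷ vs) p ag e with ∨-true {settled p} e
    ... | inj₁ s = sound p ag s
    ... | inj₂ e′ with f v in fv | ∧-true {search vs (p [ v ]≔ just true)} e′
    ...   | true | e₁ , _ = search-sound sound vs _ (extend ag fv) e₁
    ...   | false | _ , e₂ = search-sound sound vs _ (extend ag fv) e₂

    searchAll : Bool
    searchAll = search (reverse (allFin N)) (replicate N nothing)

    searchAll-sound : ∀ {f} {P : Set} → (∀ p → Agrees p f → settled p ≡ true → P) → searchAll ≡ true → P
    searchAll-sound {f} sound = search-sound sound (reverse (allFin N)) (replicate N nothing) blank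
      where
      blank : Agrees (replicate N nothing) f
      blank .value i e with () ← trans (sym (lookup-replicate {n = N} i nothing)) e

  trues : ∀ {N} → Partial N → ℕ
  trues p = sumF (λ i → ind (is true (lookup p i)))

  trues≤count : ∀ {N} {p : Partial N} {f} → Agrees p f → trues p ≤ count f
  trues≤count {f = f} ag = ≤-trans (sum-mono λ i → ind-mono (agrees-is ag i)) (≤-reflexive (sym (count≡sum f)))

  -- Placed in front of the costly tests, so that they are evaluated at complete assignments only.
  total : ∀ {N} → Partial N → Bool
  total [] = true
  total (nothing ∷ p) = false
  total (just _ ∷ p) = total p

  -- An undecided value never counts as a difference. Cut sizes of a partial assignment are
  -- therefore lower bounds for all its extensions and can end a branch early.
  differ : Maybe Bool → Maybe Bool → Bool
  differ (just x) (just y) = x xor y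
  differ _ _ = false

  agrees-differ : ∀ {N} {p : Partial N} {f} → Agrees p f → ∀ i j →
                  differ (lookup p i) (lookup p j) ≡ true → f i xor f j ≡ true
  agrees-differ {p = p} ag i j e with lookup p i in pi | lookup p j in pj
  ... | just x | just y rewrite value ag i pi | value ag j pj = e

  agrees-differʳ : ∀ {N} {p : Partial N} {f} → Agrees p f → ∀ i w →
                  differ (lookup p i) (just w) ≡ true → f i xor w ≡ true
  agrees-differʳ {p = p} ag i w e with lookup p i in pi
  ... | just x rewrite value ag i pi = e

-- Deciding the required facts about a block.

module Verification where

  open import Defs hiding (sym)
  open Sums
  open BooleanChecks
  open Blocks
  open Search
  open import Data.Bool using (Bool; true; false; T; if_then_else_; _∧_; _∨_; _xor_; not)
  open import Data.Bool.Properties using (xor-same; not-involutive)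
  open import Data.Fin using (Fin; _↑ˡ_; _↑ʳ_)
  open import Data.Fin.Patterns
  import Data.Fin as F
  open import Data.List using ([]; _∷_)
  open import Data.Bool.ListAction using (all; any)
  open import Data.List.Membership.Propositional using (_∈_)
  open import Data.List.Relation.Unary.Any using () renaming (here to hereᵃ; there to thereᵃ)
  open import Data.Maybe using (Maybe; just)
  open import Data.List.Relation.Unary.Unique.Propositional using (Unique)
  open import Data.Nat
  open import Data.Nat.Properties hiding (_≟_)
  open import Data.Product using (_×_; _,_; ∃; proj₁; proj₂)
  open import Data.Sum using (_⊎_; inj₁; inj₂)
  open import Data.Vec using (Vec; []; _∷_; lookup; _[_]≔_; tabulate)
  open import Data.Vec.Properties using (lookup∘update′; lookup∘tabulate)
  open import Relation.Nullary using (yes; no; contradiction)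
  open import Relation.Binary.PropositionalEquality

  module Verify (B : Shape) where
    open Shape B

    iff : Bool → Bool → Bool
    iff x y = not (x xor y)

    innerCutₚ : Partial size → ℕ
    innerCutₚ p = sumL (λ e → ind (differ (lookup p (proj₁ e)) (lookup p (proj₂ e)))) edges

    innerCutₚ≤ : ∀ {p f} → Agrees p f → innerCutₚ p ≤ innerCut f
    innerCutₚ≤ ag = sumL-mono (λ e → ind-mono (agrees-differ ag (proj₁ e) (proj₂ e))) edges

    nonconstantᵇ : Partial size → Bool
    nonconstantᵇ p = (3 ≤ᵇ innerCutₚ p) ∨ (allF (λ i → is true (lookup p i)) ∨ allF (λ i → is false (lookup p i)))

    nonconstant-sound : ∀ {f} p → Agrees p f → nonconstantᵇ p ≡ true → 3 ≤ innerCut f ⊎ ∃ λ c → ∀ a → f a ≡ c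
    nonconstant-sound p ag e with ∨-true {3 ≤ᵇ innerCutₚ p} e
    ... | inj₁ big = inj₁ (≤-trans (≤ᵇ-sound big) (innerCutₚ≤ ag))
    ... | inj₂ e′ with ∨-true {allF (λ i → is true (lookup p i))} e′
    ...   | inj₁ ts = inj₂ (true , λ a → agrees-is ag a (allF-sound (λ i → is true (lookup p i)) ts a))
    ...   | inj₂ fs = inj₂ (false , λ a → agrees-is ag a (allF-sound (λ i → is false (lookup p i)) fs a))

    outerCutₚ : Bool → Partial size → ℕ
    outerCutₚ w p = sumF (λ e → ind (differ (lookup p (right e)) (just w))) + sumF (λ e → ind (differ (lookup p (left e)) (just w)))

    same : Maybe Bool → Maybe Bool → Bool
    same (just x) (just y) = iff x y
    same _ _ = false

    meets : Partial size → Vertex → Vertex × Vertex → Bool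
    meets p v e = (same (lookup p (proj₁ e)) (lookup p (proj₂ e)) ∨ (proj₁ e == v)) ∨ (proj₂ e == v)

    meetsOuter : Bool → Partial size → Vertex → Vertex → Bool
    meetsOuter w p v a = is w (lookup p a) ∨ (a == v)

    starᵇ : Bool → Partial size → Vertex → Bool
    starᵇ w p v = all (meets p v) edges ∧ (allF (λ e → meetsOuter w p v (right e)) ∧ allF (λ e → meetsOuter w p v (left e)))

    contractedᵇ : Bool → Partial size → Bool
    contractedᵇ w p = (6 ≤ᵇ (innerCutₚ p + outerCutₚ w p)) ∨ (total p ∧ anyF (starᵇ w p))

    iff-sound : ∀ {x y} → iff x y ≡ true → x ≡ y
    iff-sound {true} {true} _ = refl
    iff-sound {false} {false} _ = refl

    xor-≢ : ∀ {x y} → x xor y ≡ true → x ≢ y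
    xor-≢ {x} e refl with () ← trans (sym e) (xor-same x)

    star-sound : ∀ {w p f} → Agrees p f → ∀ v → starᵇ w p v ≡ true → Star f w v
    star-sound {w} {p} {f} ag v st = record
      { star-inner = at-edge ; star-right = λ e → at-outer (allF-sound (λ e → meetsOuter w p v (right e)) (proj₁ outer) e)
      ; star-left = λ e → at-outer (allF-sound (λ e → meetsOuter w p v (left e)) (proj₂ outer) e) }
      where
      split = ∧-true {all (meets p v) edges} st
      outer = ∧-true {allF (λ e → meetsOuter w p v (right e))} (proj₂ split)
      at-edge : ∀ {a b} → (a , b) ∈ edges → f a xor f b ≡ true → a ≡ v ⊎ b ≡ v
      at-edge {a} {b} ab x with ∨-true {same (lookup p a) (lookup p b) ∨ (a == v)} (all-∈ (meets p v) (proj₁ split) ab)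
      ... | inj₂ b≡v = inj₂ (==⇒≡ b≡v)
      ... | inj₁ q with ∨-true {same (lookup p a) (lookup p b)} q
      ...   | inj₂ a≡v = inj₁ (==⇒≡ a≡v)
      ...   | inj₁ s with lookup p a in pa | lookup p b in pb
      ...     | just y | just z rewrite value ag a pa | value ag b pb = contradiction (iff-sound s) (xor-≢ {y} {z} x)
      at-outer : ∀ {a} → meetsOuter w p v a ≡ true → f a xor w ≡ true → a ≡ v
      at-outer {a} m x with ∨-true {is w (lookup p a)} m
      ... | inj₁ fa = contradiction (agrees-is ag a fa) (xor-≢ x)
      ... | inj₂ a≡v = ==⇒≡ a≡v

    contracted-sound : ∀ {w f} p → Agrees p f → contractedᵇ w p ≡ true → 6 ≤ innerCut f + outerCut f w ⊎ ∃ (Star f w)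
    contracted-sound {w} p ag e with ∨-true {6 ≤ᵇ (innerCutₚ p + outerCutₚ w p)} e
    ... | inj₁ big = inj₁ (≤-trans (≤ᵇ-sound big) (+-mono-≤ (innerCutₚ≤ ag) (+-mono-≤
            (sum-mono λ e → ind-mono (agrees-differʳ ag (right e) w)) (sum-mono λ e → ind-mono (agrees-differʳ ag (left e) w)))))
    ... | inj₂ e′ with anyF-sound (starᵇ w p) (proj₂ (∧-true {total p} e′))
    ...   | v , st = inj₂ (v , star-sound ag v st)

    bare : Partial size → Vertex × Vertex → Bool
    bare p e = is false (lookup p (proj₁ e)) ∧ is false (lookup p (proj₂ e))

    -- A branch ends at an edge with neither end chosen, or once the chosen vertices are already
    -- numerous enough; for sixteen vertices that means eleven.
    coverᵇ : Partial size → Bool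
    coverᵇ p = any (bare p) edges ∨ ((size * 4) <ᵇ (trues p * 6))

    cover-sound : ∀ {f} p → (∀ {a b} → (a , b) ∈ edges → f a ∨ f b ≡ true) → Agrees p f → coverᵇ p ≡ true → size * 4 < count f * 6
    cover-sound p cover ag e with ∨-true {any (bare p) edges} e
    ... | inj₂ big = <-≤-trans (<ᵇ⇒< (size * 4) (trues p * 6) (subst T (sym big) _)) (*-monoˡ-≤ 6 (trues≤count ag))
    ... | inj₁ q with any-∈ (bare p) edges q
    ...   | (a , b) , ab∈ , both with ∧-true {is false (lookup p a)} both
    ...     | fa , fb with () ← trans (sym (cover ab∈)) (cong₂ _∨_ (agrees-is ag a {false} fa) (agrees-is ag b {false} fb))

    Marks : Set
    Marks = Vec Bool size

    visit : (Vertex → Bool) → Vertex → Vertex → Marks → Marks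
    visit free a b R = if lookup R b ∧ free a then R [ a ]≔ true else R

    sweep : (Vertex → Bool) → Arcs size → Marks → Marks
    sweep free [] R = R
    sweep free ((a , b) ∷ es) R = sweep free es (visit free a b (visit free b a R))

    -- Every mark set on the way is justified by a path, so the number of passes is free: too few
    -- passes could only make a test fail, never accept wrongly.
    spread : (Vertex → Bool) → Marks → Marks
    spread free R = pass (pass (pass (pass R)))
      where
      pass : Marks → Marks
      pass = sweep free edges

    module _ {free f : Vertex → Bool} {S : Vertex → Set} (free-sound : ∀ a → free a ≡ true → f a ≡ false) where

      Sound : Marks → Set
      Sound R = ∀ a → lookup R a ≡ true → f a ≡ false × Reach f S a

      visit-sound : ∀ {a b} R → inner a b ≡ true → Sound R → Sound (visit free a b R)
      visit-sound {a} {b} R ab R-sound with lookup R b in Rb | free a in fa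
      ... | false | _ = R-sound
      ... | true | false = R-sound
      ... | true | true = λ c c∈ → case c c∈ (c F.≟ a)
        where
        case : ∀ c → lookup (R [ a ]≔ true) c ≡ true → Relation.Nullary.Dec (c ≡ a) → f c ≡ false × Reach f S c
        case c c∈ (yes refl) = free-sound a fa , move ab (proj₁ (R-sound b Rb)) (proj₂ (R-sound b Rb))
        case c c∈ (no c≢a) = R-sound c (trans (sym (lookup∘update′ c≢a R true)) c∈)

      sweep-sound : ∀ es R → (∀ {a b} → (a , b) ∈ es → inner a b ≡ true × inner b a ≡ true) → Sound R → Sound (sweep free es R)
      sweep-sound [] R _ R-sound = R-sound
      sweep-sound ((a , b) ∷ es) R es⊆ R-sound = sweep-sound es (visit free a b (visit free b a R)) (λ i → es⊆ (thereᵃ i))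
        (visit-sound (visit free b a R) (proj₁ (es⊆ (hereᵃ refl)))
          (visit-sound R (proj₂ (es⊆ (hereᵃ refl))) R-sound))

      spread-sound : ∀ R → Sound R → Sound (spread free R)
      spread-sound R R-sound = pass _ (pass _ (pass _ (pass R R-sound)))
        where
        pass : ∀ R → Sound R → Sound (sweep free edges R)
        pass R = sweep-sound edges R (λ ab → edge-inner ab , edge-inner′ ab)

    covers : ∀ {N} → Partial N → (Vertex → Fin N) → Marks → Bool
    covers p at R = allF (λ a → is true (lookup p (at a)) ∨ lookup R a)

    -- `at` places the vertices among the searched positions: the identity for `block-connected`,
    -- `_↑ˡ 6` for `block-escape`, where six flags for outer neighbours are added.
    spread-covers : ∀ {N} {p : Partial N} {f} (at : Vertex → Fin N) {S} (start : Vertex → Bool) → Agrees p f →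
      (∀ a → start a ≡ true → S a) →
      covers p at (spread (λ a → is false (lookup p (at a))) (tabulate (λ a → is false (lookup p (at a)) ∧ start a))) ≡ true →
      ∀ a → f (at a) ≡ false → Reach (λ a → f (at a)) S a
    spread-covers {p = p} {f} at {S} start ag start-sound cov a fa
      with ∨-true {is true (lookup p (at a))} (allF-sound (λ a → is true (lookup p (at a)) ∨ lookup (spread free init) a) cov a)
      where
      free : Vertex → Bool
      free a = is false (lookup p (at a))
      init : Marks
      init = tabulate (λ a → free a ∧ start a)
    ... | inj₁ ta with () ← trans (sym fa) (agrees-is ag (at a) {true} ta)
    ... | inj₂ Ra = proj₂ (spread-sound (λ a → agrees-is ag (at a)) _ init-sound a Ra)
      where
      init-sound : ∀ a → lookup (tabulate (λ a → is false (lookup p (at a)) ∧ start a)) a ≡ true → f (at a) ≡ false × Reach (λ a → f (at a)) S a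
      init-sound a q with ∧-true {is false (lookup p (at a))} (trans (sym (lookup∘tabulate (λ a → is false (lookup p (at a)) ∧ start a) a)) q)
      ... | fa , sa = agrees-is ag (at a) fa , stop (start-sound a sa)

    joinedᵇ : Partial size → Vertex → Bool
    joinedᵇ p r = is false (lookup p r) ∧
      covers p (λ a → a) (spread (λ a → is false (lookup p a)) (tabulate (λ a → is false (lookup p a) ∧ (a == r))))

    connectedᵇ : Partial size → Bool
    connectedᵇ p = (2 ≤ᵇ trues p) ∨ (total p ∧ anyF (joinedᵇ p))

    connected-sound : ∀ {f} p → Agrees p f → connectedᵇ p ≡ true →
      2 ≤ count f ⊎ ∃ λ r → f r ≡ false × (∀ a → f a ≡ false → Reach f (_≡ r) a)
    connected-sound p ag e with ∨-true {2 ≤ᵇ trues p} e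
    ... | inj₁ big = inj₁ (≤-trans (≤ᵇ-sound big) (trues≤count ag))
    ... | inj₂ e′ with anyF-sound (joinedᵇ p) (proj₂ (∧-true {total p} e′))
    ...   | r , j with ∧-true {is false (lookup p r)} j
    ...     | fr , cov = inj₂ (r , agrees-is ag r fr , spread-covers (λ a → a) (_== r) ag (λ a → ==⇒≡) cov)

    openᵇ : Partial (size + 6) → Vertex → Fin 6 → Bool
    openᵇ p a e = (exit e == a) ∧ is false (lookup p (size ↑ʳ e))

    -- Four deletions settle a branch, so reachability is computed only for assignments with at most
    -- three of the `size + 6` positions deleted.
    escapeᵇ : Partial (size + 6) → Bool
    escapeᵇ p = (4 ≤ᵇ trues p) ∨ (total p ∧ covers p (_↑ˡ 6)
      (spread (λ a → is false (lookup p (a ↑ˡ 6))) (tabulate (λ a → is false (lookup p (a ↑ˡ 6)) ∧ anyF (openᵇ p a)))))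

    escape-sound : ∀ {f} p → Agrees p f → escapeᵇ p ≡ true →
      4 ≤ count f ⊎ (∀ a → f (a ↑ˡ 6) ≡ false → Reach (λ a → f (a ↑ˡ 6)) (Exit f) a)
    escape-sound {f} p ag e with ∨-true {4 ≤ᵇ trues p} e
    ... | inj₁ big = inj₁ (≤-trans (≤ᵇ-sound big) (trues≤count ag))
    ... | inj₂ e′ = inj₂ (spread-covers (_↑ˡ 6) (λ a → anyF (openᵇ p a)) ag open-sound (proj₂ (∧-true {total p} e′)))
      where
      open-sound : ∀ a → anyF (openᵇ p a) ≡ true → Exit f a
      open-sound a any with anyF-sound (openᵇ p a) any
      ... | e , o with ∧-true {exit e == a} o
      ...   | e≡a , fe = e , ==⇒≡ e≡a , agrees-is ag (size ↑ʳ e) fe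

    record Checked : Set where
      field
        inner-irreflᶜ : allF (λ a → not (inner a a)) ≡ true
        mult-dartsᶜ : allF (λ a → allF λ b → mult darts a b ≡ᵇ ind (inner a b)) ≡ true
        mult-linksᶜ : allF (λ a → allF λ b → mult links a b ≡ᵇ ind (link a b)) ≡ true
        valencyᶜ : allF (λ a → valency a ≡ᵇ 4) ≡ true
        nonconstantᶜ : searchAll nonconstantᵇ ≡ true
        contractedᶜ : ∀ w → searchAll (contractedᵇ w) ≡ true
        coverᶜ : searchAll coverᵇ ≡ true
        connectedᶜ : searchAll connectedᵇ ≡ true
        escapeᶜ : searchAll escapeᵇ ≡ true

    checked⇒sturdy : Unique (right 0F ∷ right 1F ∷ right 2F ∷ []) → Unique (left 0F ∷ left 1F ∷ left 2F ∷ []) → Checked → Sturdy B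
    checked⇒sturdy right! left! checked = record
      { right! = right! ; left! = left!
      ; inner-irrefl = λ a → trans (sym (not-involutive _)) (cong not (allF-sound (λ a → not (inner a a)) inner-irreflᶜ a))
      ; mult-darts = λ a b → ≡ᵇ-sound (allF₂-sound (λ a b → mult darts a b ≡ᵇ ind (inner a b)) mult-dartsᶜ a b)
      ; mult-links = λ a b → ≡ᵇ-sound (allF₂-sound (λ a b → mult links a b ≡ᵇ ind (link a b)) mult-linksᶜ a b)
      ; valency≡4 = λ a → ≡ᵇ-sound (allF-sound (λ a → valency a ≡ᵇ 4) valencyᶜ a)
      ; innerCut-nonconstant = λ f → searchAll-sound nonconstantᵇ {f} nonconstant-sound nonconstantᶜ
      ; contracted-cut = λ f w → searchAll-sound (contractedᵇ w) {f} contracted-sound (contractedᶜ w)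
      ; cover-size = λ f cover → searchAll-sound coverᵇ {f} (λ p → cover-sound p cover) coverᶜ
      ; block-connected = λ f → searchAll-sound connectedᵇ {f} connected-sound connectedᶜ
      ; block-escape = λ f → searchAll-sound escapeᵇ {f} escape-sound escapeᶜ
      }
      where
      open Checked checked

-- The block on sixteen vertices.

module ConcreteBlock where

  open Sums
  open Blocks
  open Verification
  open import Data.Bool using (true; false)
  open import Data.Fin using (Fin; suc)
  open import Data.Fin.Patterns
  open import Data.List using ([]; _∷_)
  open import Data.List.Relation.Unary.All using ([]; _∷_)
  open import Data.List.Relation.Unary.AllPairs using ([]; _∷_)
  open import Data.Product using (_,_)
  open import Relation.Binary.PropositionalEquality

  pattern 10F = suc 9F
  pattern 11F = suc 10F
  pattern 12F = suc 11F
  pattern 13F = suc 12F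
  pattern 14F = suc 13F
  pattern 15F = suc 14F

  -- i ~ i + 1 and i ~ i + 2 modulo 16, except for 0 ~ 2, 6 ~ 8 and 12 ~ 14.
  blockEdges : Arcs 16
  blockEdges =
    (0F , 1F) ∷ (0F , 14F) ∷ (0F , 15F) ∷ (1F , 2F) ∷ (1F , 3F) ∷ (1F , 15F) ∷ (2F , 3F) ∷ (2F , 4F) ∷
    (3F , 4F) ∷ (3F , 5F) ∷ (4F , 5F) ∷ (4F , 6F) ∷ (5F , 6F) ∷ (5F , 7F) ∷ (6F , 7F) ∷ (7F , 8F) ∷
    (7F , 9F) ∷ (8F , 9F) ∷ (8F , 10F) ∷ (9F , 10F) ∷ (9F , 11F) ∷ (10F , 11F) ∷ (10F , 12F) ∷
    (11F , 12F) ∷ (11F , 13F) ∷ (12F , 13F) ∷ (13F , 14F) ∷ (13F , 15F) ∷ (14F , 15F) ∷ []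

  -- The ends of the removed chords, which follow each other on their face as 0, 2, 6, 8, 12, 14;
  -- the first three are used on the left and the others on the right. The reflection a ↦ 14 - a
  -- takes `leftEnd e` to `rightEnd e`, so both sides are read in the same order and the links can
  -- run side by side.
  rightEnd leftEnd : Fin 3 → Fin 16
  rightEnd 0F = 14F
  rightEnd 1F = 12F
  rightEnd 2F = 8F
  leftEnd 0F = 0F
  leftEnd 1F = 2F
  leftEnd 2F = 6F

  block : Shape
  block = record { size = 16 ; edges = blockEdges ; right = rightEnd ; left = leftEnd }



  sturdy : Sturdy block
  sturdy = checked⇒sturdy (((λ ()) ∷ (λ ()) ∷ []) ∷ ((λ ()) ∷ []) ∷ [] ∷ []) (((λ ()) ∷ (λ ()) ∷ []) ∷ ((λ ()) ∷ []) ∷ [] ∷ []) record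
    { inner-irreflᶜ = refl ; mult-dartsᶜ = refl ; mult-linksᶜ = refl ; valencyᶜ = refl
    ; nonconstantᶜ = refl ; contractedᶜ = λ { true → refl ; false → refl } ; coverᶜ = refl
    ; connectedᶜ = refl ; escapeᶜ = refl }
    where open Verify block

-- Coordinates for the three kinds of block.

module ConcreteLayout where

  open Layouts
  open ConcreteBlock
  open import Data.List using ([]; _∷_)
  open import Data.Nat hiding (_<?_)
  open import Data.Product using (_×_; _,_)
  open import Data.Vec using (Vec; []; _∷_; lookup)
  open import Relation.Binary.PropositionalEquality

  -- In the first block the even vertices lie on the parabola x = 49 − (y − 7)², so that each can be seen from the
  -- right; the last block is its mirror image under the automorphism a ↦ 14 − a.
  table : Kind → Vec (ℕ × ℕ) 16
  table first =
    (48 , 8) ∷ (39 , 9) ∷ (40 , 10) ∷ (27 , 11) ∷ (24 , 12) ∷ (7 , 13) ∷ (0 , 14) ∷ (2 , 7) ∷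
    (0 , 0) ∷ (7 , 1) ∷ (24 , 2) ∷ (27 , 3) ∷ (40 , 4) ∷ (39 , 5) ∷ (48 , 6) ∷ (43 , 7) ∷ []
  table middle =
    (9 , 6) ∷ (8 , 5) ∷ (1 , 4) ∷ (5 , 3) ∷ (1 , 2) ∷ (8 , 1) ∷ (9 , 0) ∷ (24 , 1) ∷
    (40 , 0) ∷ (41 , 1) ∷ (48 , 2) ∷ (44 , 3) ∷ (48 , 4) ∷ (41 , 5) ∷ (40 , 6) ∷ (24 , 5) ∷ []
  table last =
    (1 , 6) ∷ (10 , 5) ∷ (9 , 4) ∷ (22 , 3) ∷ (25 , 2) ∷ (42 , 1) ∷ (49 , 0) ∷ (47 , 7) ∷
    (49 , 14) ∷ (42 , 13) ∷ (25 , 12) ∷ (22 , 11) ∷ (9 , 10) ∷ (10 , 9) ∷ (1 , 8) ∷ (6 , 7) ∷ []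

  layout : Layout block
  layout = checked⇒layout record
    { innerᶜ = λ { first → refl ; middle → refl ; last → refl }
    ; linkᶜ = λ { first middle → refl ; first last → refl ; middle middle → refl ; middle last → refl }
    ; hereᶜ = λ { first middle → refl ; first last → refl ; middle middle → refl ; middle last → refl }
    ; thereᶜ = λ { first middle → refl ; first last → refl ; middle middle → refl ; middle last → refl }
    ; ray-rightᶜ = refl ; ray-leftᶜ = refl
    ; widthᶜ = λ { first → refl ; middle → refl ; last → refl }
    ; middle-leftᶜ = refl ; middle-rightᶜ = refl ; middle-lowᶜ = refl
    ; start-lowᶜ = λ { first → refl ; middle → refl }
    ; end-lowᶜ = λ { middle → refl ; last → refl }
    ; closing-highᶜ = refl ; closing-levelᶜ = refl ; closing-distinctᶜ = refl
    }
    where open CheckLayout block (λ κ a → lookup (table κ) a)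

open import Defs
open import Data.Nat using (ℕ; _<_; z≤n; s≤s)
open import Data.Nat.Divisibility using (_∣_)
open import Data.Product using (Σ; _×_)
open import Relation.Nullary using (¬_)
open ConcreteBlock using (block; sturdy)
open ConcreteLayout using (layout)
open Family using (necklaces)

theorem2p1 : ∀ (N : ℕ) → Σ Graph λ G →
    N < n G × Planar G × KConnected 4 G × EssEdgeConnected 6 G ×
    Regular 4 G × 3 ∣ edgeCount G × ¬ ClawDecomposition G
theorem2p1 = necklaces block sturdy layout (s≤s (s≤s z≤n))
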